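{- Let $\mathcal P$ be a chiral polytope of type $\{p_1, \ldots, p_{n-1}\}$, and suppose that \[ \left( \frac{|\Gamma^+(\mathcal P) \diamond \Gamma^+(\overline{\mathcal P})|}{|\Gamma^+(\mathcal P)|} \right)^2 > \left|[p_1, \ldots, p_{n-1}]^+ \mathbin{\square} [p_{n-1}, \ldots, p_1]^+\right|. \] Then $\mathcal P \diamond \mathcal P^{\delta}$ is chiral.
   Context: An abstract polytope of rank $n$ (an $n$-polytope) is a ranked poset of faces with ranks from $-1$ to $n$, with a unique least face (rank $-1$) and a unique greatest face (rank $n$), in which every flag (maximal chain) has $n+2$ faces, which satisfies the diamond condition (whenever $F<G$ with ranks $j-1$ and $j+1$ there are exactly two $j$-faces strictly between them), and which is strongly flag-connected (any two flags $\Phi,\Psi$ are joined by a sequence of flags, consecutive ones adjacent, all containing $\Phi\cap\Psi$; two flags are adjacent if they differ in exactly one face). $\Phi^j$ denotes the unique flag differing from $\Phi$ only in its $j$-face, and $\Phi^{i,j}=(\Phi^i)^j$. Each polytope considered has a fixed base flag $\Phi$. $\mathcal P$ is chiral if its automorphism group $\Gamma(\mathcal P)$ has exactly two orbits on flags and adjacent flags lie in distinct orbits; then $\Gamma^+(\mathcal P):=\Gamma(\mathcal P)$ is generated by $\sigma_1,\dots,\sigma_{n-1}$, where $\sigma_i$ maps $\Phi$ to $\Phi^{i,i-1}$. One has $(\sigma_i\cdots\sigma_j)^2=1$ for $i<j$, and the type of $\mathcal P$ is $\{p_1,\dots,p_{n-1}\}$ where $p_i$ is the order of $\sigma_i$.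 $[p_1,\dots,p_{n-1}]^+$ denotes the rotation subgroup of the string Coxeter group $[p_1,\dots,p_{n-1}]$, i.e. the group $\langle\sigma_1,\dots,\sigma_{n-1}\mid \sigma_i^{p_i}=1\ (1\le i\le n-1),\ (\sigma_i\cdots\sigma_j)^2=1\ (1\le i<j\le n-1)\rangle$ with these specified generators (the relation $\sigma_i^{p_i}=1$ being omitted if $p_i=\infty$). Let $W^+=\langle \sigma_1,\dots,\sigma_{n-1}\mid (\sigma_i\cdots\sigma_j)^2=1 \text{ for } 1\le i<j\le n-1\rangle$. Writing $\Gamma^+(\mathcal P)=W^+/M$ means that $M$ is the kernel of the epimorphism $W^+\to\Gamma^+(\mathcal P)$ preserving the specified generators. For $w\in W^+$, $\overline w$ is obtained by replacing $\sigma_1$ by $\sigma_1^{ -1}$, $\sigma_2$ by $\sigma_1^2\sigma_2$ and fixing $\sigma_j$ for $j\ge3$; $\delta(w)$ is obtained by replacing each $\sigma_i$ by $\sigma_{n-i}^{ -1}$ (both are automorphisms of $W^+$). Put $\overline M=\{\overline w:w\in M\}$, $\delta(M)=\{\delta(w):w\in M\}$; one has $\delta(\overline M)=\overline{\delta(M)}$. If $\Gamma^+(\mathcal P)=W^+/M$ with $\mathcal P$ chiral, then $\overline M\ne M$; the mirror image $\overline{\mathcal P}$ (same faces, base flag $\Phi^0$) has $\Gamma^+(\overline{\mathcal P})=W^+/\overline M$, and the dual $\mathcal P^\delta$ (reversed order) has $\Gamma^+(\mathcal P^\delta)=W^+/\delta(M)$. Mix and comix: for groups with specified generators $\Gamma=\langle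 x_1,\dots,x_k\mid R\rangle$, $\Gamma'=\langle x_1',\dots,x_k'\mid S\rangle$, the mix $\Gamma\diamond\Gamma'$ is the subgroup of $\Gamma\times\Gamma'$ with specified generators $(x_i,x_i')$, $i=1,\dots,k$, and the comix $\Gamma\mathbin{\square}\Gamma'$ is the group $\langle x_1,x_1',\dots,x_k,x_k'\mid R,S,x_1^{ -1}x_1',\dots,x_k^{ -1}x_k'\rangle$. $\mathcal P\diamond\mathcal Q$ is the flag-connected pre-polytope (polytope axioms with strong flag-connectedness weakened to flag-connectedness) built from $\Gamma^+(\mathcal P)\diamond\Gamma^+(\mathcal Q)$; it is handled through $\Gamma^+(\mathcal P\diamond\mathcal Q)=\Gamma^+(\mathcal P)\diamond\Gamma^+(\mathcal Q)=W^+/N$, and it is directly regular if $\overline N=N$ and chiral if $\overline N\ne N$ (it need not be polytopal). -}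

module Defs where

open import Level using (Level; _⊔_; 0ℓ) renaming (suc to lsuc)
open import Algebra.Bundles using (Group)
open import Algebra.Definitions.RawMonoid using (_×_)
import Algebra.Construct.DirectProduct as Product
open import Data.Empty using (⊥-elim)
open import Data.Fin.Base as Fin using (Fin; zero; suc; toℕ; fromℕ; inject₁; opposite)
open import Data.Fin.Properties as Finₚ using (opposite-prop; opposite-involutive; toℕ-inject₁; toℕ-injective)
open import Data.List.Base using (List; []; _∷_)
open import Data.List.Relation.Unary.All as All using (All; []; _∷_)
open import Data.List.Relation.Unary.Any as Any using (Any)
open import Data.List.Relation.Unary.AllPairs as AllPairs using (AllPairs; []; _∷_)
open import Data.Nat.Base as ℕ using (ℕ; zero; suc; z≤n; s≤s)
import Data.Nat.Properties as ℕₚ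
open import Data.Product.Base as Prod using (Σ; ∃; _,_; proj₁; proj₂) renaming (_×_ to _∧_)
open import Data.Sum.Base as Sum using (_⊎_; inj₁; inj₂)
open import Function.Base using (_∘_; id)
open import Function.Bundles using (Inverse)
open import Relation.Binary.Bundles using (Poset)
open import Relation.Binary.Construct.Closure.ReflexiveTransitive as Star using (Star; _◅_)
open import Relation.Binary.Core using (Rel)
open import Relation.Binary.Definitions using (Minimum; Maximum)
open import Relation.Binary.PropositionalEquality as ≡ using (_≡_; _≢_)
import Relation.Binary.Properties.Poset as PosetProperties
open import Relation.Nullary using (¬_; yes; no; contradiction)
open import Relation.Unary using (Pred; _≐_)

private
  variable
    c ℓ₁ ℓ₂ a b ℓ ℓ′ : Level
    X Y : Set
    k m n : ℕ

opposite-antitone : {i j : Fin n} → i Fin.≤ j → opposite j Fin.≤ opposite i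
opposite-antitone {n} {i} {j} i≤j =
  ≡.subst₂ ℕ._≤_ (≡.sym (opposite-prop j)) (≡.sym (opposite-prop i))
    (ℕₚ.∸-monoʳ-≤ n (s≤s i≤j))

opposite-antitone-< : {i j : Fin n} → i Fin.< j → opposite j Fin.< opposite i
opposite-antitone-< {n} {i} {j} i<j =
  ≡.subst₂ ℕ._<_ (≡.sym (opposite-prop j)) (≡.sym (opposite-prop i))
    (ℕₚ.∸-monoʳ-< (s≤s i<j) (Finₚ.toℕ<n j))

opposite-reflects-≤ : {i j : Fin n} → opposite i Fin.≤ opposite j → j Fin.≤ i
opposite-reflects-≤ {i = i} {j} p =
  ≡.subst₂ Fin._≤_ (opposite-involutive j) (opposite-involutive i) (opposite-antitone p)

opposite-+ : (i : Fin (suc n)) → toℕ (opposite i) ℕ.+ toℕ i ≡ n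
opposite-+ {n} i =
  ≡.trans (≡.cong (ℕ._+ toℕ i) (opposite-prop i)) (ℕₚ.m∸n+n≡m (ℕₚ.≤-pred (Finₚ.toℕ<n i)))

opposite-shift : ∀ d (i j : Fin (suc n)) →
                 toℕ j ≡ d ℕ.+ toℕ i → toℕ (opposite i) ≡ d ℕ.+ toℕ (opposite j)
opposite-shift {n} d i j e = ℕₚ.+-cancelʳ-≡ (toℕ i) _ _ (begin
  toℕ (opposite i) ℕ.+ toℕ i             ≡⟨ opposite-+ i ⟩
  n                                      ≡⟨ opposite-+ j ⟨
  toℕ (opposite j) ℕ.+ toℕ j             ≡⟨ ≡.cong (toℕ (opposite j) ℕ.+_) e ⟩
  toℕ (opposite j) ℕ.+ (d ℕ.+ toℕ i)     ≡⟨ ℕₚ.+-assoc (toℕ (opposite j)) d (toℕ i) ⟨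
  toℕ (opposite j) ℕ.+ d ℕ.+ toℕ i       ≡⟨ ≡.cong (ℕ._+ toℕ i) (ℕₚ.+-comm (toℕ (opposite j)) d) ⟩
  d ℕ.+ toℕ (opposite j) ℕ.+ toℕ i       ∎)
  where open ≡.≡-Reasoning

module _ (f : Fin n → Fin n) (f-< : ∀ {i j} → i Fin.< j → f i Fin.< f j) where
  increasing-≥ : ∀ t (i : Fin n) → toℕ i ≡ t → t ℕ.≤ toℕ (f i)
  increasing-≥ zero    i       _ = z≤n
  increasing-≥ (suc t) (suc i) e =
    ℕₚ.≤-<-trans
      (increasing-≥ t (inject₁ i) (≡.trans (toℕ-inject₁ i) (ℕₚ.suc-injective e)))
      (f-< (s≤s (ℕₚ.≤-reflexive (toℕ-inject₁ i))))

increasing⇒id : (f : Fin n → Fin n) → (∀ {i j} → i Fin.< j → f i Fin.< f j) → ∀ i → f i ≡ i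
increasing⇒id f f-< i = Finₚ.≤-antisym
  (opposite-reflects-≤ (≡.subst (λ x → opposite i Fin.≤ opposite (f x)) (opposite-involutive i)
    (increasing-≥ (opposite ∘ f ∘ opposite)
      (opposite-antitone-< ∘ f-< ∘ opposite-antitone-<) _ (opposite i) ≡.refl)))
  (increasing-≥ f f-< _ i ≡.refl)

-- `rank F` is the usual rank of F plus one, so ranks -1, …, n become
-- 0, …, n+1.  The two monotonicity laws together say that F < G implies
-- rank F < rank G, in a form which does not need decidable equality.
record RankedPoset (n : ℕ) (c ℓ₁ ℓ₂ : Level) : Set (lsuc (c ⊔ ℓ₁ ⊔ ℓ₂)) where
  field
    poset : Poset c ℓ₁ ℓ₂

  open Poset poset public renaming (Carrier to Face)
  open PosetProperties poset public using (_<_)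

  field
    rank        : Face → Fin (suc (suc n))
    rank-mono   : ∀ {F G} → F ≤ G → rank F Fin.≤ rank G
    rank-strict : ∀ {F G} → F ≤ G → rank F ≡ rank G → F ≈ G

  rank-cong : ∀ {F G} → F ≈ G → rank F ≡ rank G
  rank-cong F≈G = Finₚ.≤-antisym (rank-mono (reflexive F≈G)) (rank-mono (reflexive (Eq.sym F≈G)))

  Comparable : Rel Face ℓ₂
  Comparable F G = F ≤ G ⊎ G ≤ F

  IsChain : List Face → Set (c ⊔ ℓ₂)
  IsChain = AllPairs Comparable

  -- A chain with n+2 faces, listed by rank.  Such a chain is maximal.
  record Flag : Set (c ⊔ ℓ₂) where
    field
      face      : Fin (suc (suc n)) → Face
      face-rank : ∀ i → rank (face i) ≡ i
      face-mono : ∀ {i j} → i Fin.≤ j → face i ≤ face j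

  open Flag public

  infix 4 _≋_ _∈_

  _≋_ : Rel Flag ℓ₁
  Φ ≋ Ψ = ∀ i → face Φ i ≈ face Ψ i

  _∈_ : Face → Flag → Set ℓ₁
  F ∈ Φ = ∃ λ i → face Φ i ≈ F

  DifferExactlyAt : Fin (suc (suc n)) → Rel Flag ℓ₁
  DifferExactlyAt j Φ Ψ = (¬ face Φ j ≈ face Ψ j) ∧ (∀ i → i ≢ j → face Φ i ≈ face Ψ i)

  Adjacent : Rel Flag ℓ₁
  Adjacent Φ Ψ = ∃ λ j → DifferExactlyAt j Φ Ψ

  -- G is a face strictly between F and H, one rank above F.
  Between : Face → Face → Face → Set (ℓ₁ ⊔ ℓ₂)
  Between F H G = F < G ∧ G < H ∧ toℕ (rank G) ≡ 1 ℕ.+ toℕ (rank F)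

  record ExactlyTwo {p} (P : Pred Face p) : Set (c ⊔ ℓ₁ ⊔ p) where
    field
      fst snd  : Face
      fst∈     : P fst
      snd∈     : P snd
      distinct : ¬ fst ≈ snd
      only     : ∀ G → P G → G ≈ fst ⊎ G ≈ snd

  AdjacentAbove : Flag → Flag → Rel Flag (c ⊔ ℓ₁)
  AdjacentAbove Φ Ψ Θ Θ′ = Adjacent Θ Θ′ ∧ (∀ {F} → F ∈ Φ → F ∈ Ψ → F ∈ Θ′)

record Polytope (n : ℕ) (c ℓ₁ ℓ₂ : Level) : Set (lsuc (c ⊔ ℓ₁ ⊔ ℓ₂)) where
  field
    rankedPoset : RankedPoset n c ℓ₁ ℓ₂

  open RankedPoset rankedPoset public

  -- `flagged` is the axiom that every maximal chain has n+2 faces.  Chains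
  -- are finite because ranks are bounded, so this says that every chain lies
  -- in one with a face of each rank; compare `maximal⇒full` below.
  field
    least     : ∃ λ F → rank F ≡ zero ∧ Minimum _≤_ F
    greatest  : ∃ λ F → rank F ≡ fromℕ (suc n) ∧ Maximum _≤_ F
    flagged   : ∀ Fs → IsChain Fs → ∃ λ Φ → All (_∈ Φ) Fs
    diamond   : ∀ F H → F < H → toℕ (rank H) ≡ 2 ℕ.+ toℕ (rank F) → ExactlyTwo (Between F H)
    connected : ∀ Φ Ψ → ∃ λ Θ → Star (AdjacentAbove Φ Ψ) Φ Θ ∧ Θ ≋ Ψ

  maximal⇒full : ∀ Fs → IsChain Fs → (∀ G → All (Comparable G) Fs → Any (G ≈_) Fs) →
                 ∀ i → Any (λ F → rank F ≡ i) Fs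
  maximal⇒full Fs chain max i with flagged Fs chain
  ... | Φ , Fs⊆Φ = Any.map (λ e → ≡.trans (≡.sym (rank-cong e)) (face-rank Φ i))
                     (max (face Φ i) (All.map comparable Fs⊆Φ))
    where
    comparable : ∀ {F} → F ∈ Φ → Comparable (face Φ i) F
    comparable (j , e) with Finₚ.≤-total i j
    ... | inj₁ i≤j = inj₁ (trans (face-mono Φ i≤j) (reflexive e))
    ... | inj₂ j≤i = inj₂ (trans (reflexive (Eq.sym e)) (face-mono Φ j≤i))

  at below above : Fin n → Fin (suc (suc n))
  at    j = suc (inject₁ j)
  below j = inject₁ (inject₁ j)
  above j = suc (suc j)

  toℕ-below : ∀ j → toℕ (below j) ≡ toℕ j
  toℕ-below j = ≡.trans (toℕ-inject₁ (inject₁ j)) (toℕ-inject₁ j)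

  toℕ-at : ∀ j → toℕ (at j) ≡ suc (toℕ j)
  toℕ-at j = ≡.cong suc (toℕ-inject₁ j)

  below<at : ∀ j → below j Fin.< at j
  below<at j = ℕₚ.≤-reflexive (≡.trans (≡.cong suc (toℕ-below j)) (≡.sym (toℕ-at j)))

  at<above : ∀ j → at j Fin.< above j
  at<above j = ℕₚ.≤-reflexive (≡.cong suc (toℕ-at j))

  face-< : ∀ Φ {i j} → i Fin.< j → face Φ i < face Φ j
  face-< Φ {i} {j} i<j = face-mono Φ (ℕₚ.<⇒≤ i<j) ,
    λ e → Finₚ.<⇒≢ i<j (≡.trans (≡.sym (face-rank Φ i)) (≡.trans (rank-cong e) (face-rank Φ j)))

  rank-face : ∀ Φ i → toℕ (rank (face Φ i)) ≡ toℕ i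
  rank-face Φ i = ≡.cong toℕ (face-rank Φ i)

  section : ∀ Φ j → ExactlyTwo (Between (face Φ (below j)) (face Φ (above j)))
  section Φ j = diamond _ _ (face-< Φ (ℕₚ.<-trans (below<at j) (at<above j)))
    (≡.trans (rank-face Φ (above j))
      (≡.cong (2 ℕ.+_) (≡.sym (≡.trans (rank-face Φ (below j)) (toℕ-below j)))))

  face-between : ∀ Φ j → Between (face Φ (below j)) (face Φ (above j)) (face Φ (at j))
  face-between Φ j = face-< Φ (below<at j) , face-< Φ (at<above j) ,
    ≡.trans (rank-face Φ (at j)) (≡.trans (toℕ-at j)
      (≡.cong suc (≡.sym (≡.trans (rank-face Φ (below j)) (toℕ-below j)))))

  replace : ∀ Φ j G → Between (face Φ (below j)) (face Φ (above j)) G → Flag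
  replace Φ j G (F<G , G<H , rankG) = record
    { face = new ; face-rank = new-rank ; face-mono = λ {i} {i′} → new-mono i i′ }
    where
    new : Fin (suc (suc n)) → Face
    new i with i Finₚ.≟ at j
    ... | yes _ = G
    ... | no  _ = face Φ i

    new-rank : ∀ i → rank (new i) ≡ i
    new-rank i with i Finₚ.≟ at j
    ... | no  _      = face-rank Φ i
    ... | yes ≡.refl = toℕ-injective (≡.trans rankG
      (≡.trans (≡.cong suc (≡.trans (rank-face Φ (below j)) (toℕ-below j))) (≡.sym (toℕ-at j))))

    new-mono : ∀ i i′ → i Fin.≤ i′ → new i ≤ new i′
    new-mono i i′ i≤i′ with i Finₚ.≟ at j | i′ Finₚ.≟ at j
    ... | yes _      | yes _      = refl
    ... | no _       | no _       = face-mono Φ i≤i′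
    ... | yes ≡.refl | no i′≢     = trans (proj₁ G<H) (face-mono Φ
            (≡.subst (ℕ._≤ toℕ i′) (≡.cong suc (toℕ-at j)) (Finₚ.≤∧≢⇒< i≤i′ (i′≢ ∘ ≡.sym))))
    ... | no i≢      | yes ≡.refl = trans (face-mono Φ
            (≡.subst (toℕ i ℕ.≤_) (≡.trans (toℕ-inject₁ j) (≡.sym (toℕ-below j)))
              (ℕₚ.≤-pred (Finₚ.≤∧≢⇒< i≤i′ i≢)))) (proj₁ F<G)

  -- Φ ^ j is the flag differing from Φ exactly in its face of rank j (here j
  -- is the unshifted rank, `at j` its index in a flag): the
  -- face there is replaced by the other of the two given by the diamond
  -- condition.
  infixl 8 _^_

  _^_ : Flag → Fin n → Flag
  Φ ^ j with ExactlyTwo.only (section Φ j) _ (face-between Φ j)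
  ... | inj₁ _ = replace Φ j _ (ExactlyTwo.snd∈ (section Φ j))
  ... | inj₂ _ = replace Φ j _ (ExactlyTwo.fst∈ (section Φ j))

  replace-differs : ∀ Φ j G bt → ¬ face Φ (at j) ≈ G → DifferExactlyAt (at j) Φ (replace Φ j G bt)
  replace-differs Φ j G bt ≉G = differs , agrees
    where
    differs : ¬ face Φ (at j) ≈ face (replace Φ j G bt) (at j)
    differs with at j Finₚ.≟ at j
    ... | yes _ = ≉G
    ... | no ≢  = ⊥-elim (≢ ≡.refl)

    agrees : ∀ i → i ≢ at j → face Φ i ≈ face (replace Φ j G bt) i
    agrees i i≢ with i Finₚ.≟ at j
    ... | yes e = contradiction e i≢
    ... | no _  = Eq.refl

  ^-differs : ∀ Φ j → DifferExactlyAt (at j) Φ (Φ ^ j)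
  ^-differs Φ j with ExactlyTwo.only (section Φ j) _ (face-between Φ j)
  ... | inj₁ e = replace-differs Φ j _ _ (λ e′ → ExactlyTwo.distinct (section Φ j) (Eq.trans (Eq.sym e) e′))
  ... | inj₂ e = replace-differs Φ j _ _ (λ e′ → ExactlyTwo.distinct (section Φ j) (Eq.trans (Eq.sym e′) e))

  record Automorphism : Set (c ⊔ ℓ₁ ⊔ ℓ₂) where
    field
      to from   : Face → Face
      to-mono   : ∀ {F G} → F ≤ G → to F ≤ to G
      from-mono : ∀ {F G} → F ≤ G → from F ≤ from G
      to-from   : ∀ F → to (from F) ≈ F
      from-to   : ∀ F → from (to F) ≈ F

    to-cong : ∀ {F G} → F ≈ G → to F ≈ to G
    to-cong e = antisym (to-mono (reflexive e)) (to-mono (reflexive (Eq.sym e)))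

    from-cong : ∀ {F G} → F ≈ G → from F ≈ from G
    from-cong e = antisym (from-mono (reflexive e)) (from-mono (reflexive (Eq.sym e)))

    rank-flag : ∀ Φ i → rank (to (face Φ i)) ≡ i
    rank-flag Φ = increasing⇒id (λ i → rank (to (face Φ i))) λ {i} {j} i<j →
      Finₚ.≤∧≢⇒< (rank-mono (to-mono (face-mono Φ (ℕₚ.<⇒≤ i<j)))) λ e →
        proj₂ (face-< Φ i<j) (Eq.trans (Eq.sym (from-to _))
          (Eq.trans (from-cong (rank-strict (to-mono (face-mono Φ (ℕₚ.<⇒≤ i<j))) e)) (from-to _)))

    rank-to : ∀ F → rank (to F) ≡ rank F
    rank-to F with flagged (F ∷ []) ([] ∷ [])
    ... | Φ , (i , e) ∷ [] =
      ≡.trans (≡.sym (rank-cong (to-cong e)))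
        (≡.trans (rank-flag Φ i) (≡.trans (≡.sym (face-rank Φ i)) (rank-cong e)))

  open Automorphism

  -- Automorphisms act on the right: γ ∙ δ is γ followed by δ.  With this
  -- convention σᵢ : Φ ↦ Φ^{i,i-1} satisfies (σᵢ⋯σⱼ)² = 1 for i < j.
  Γ : Group (c ⊔ ℓ₁ ⊔ ℓ₂) (c ⊔ ℓ₁)
  Γ = record
    { Carrier = Automorphism
    ; _≈_     = λ γ δ → ∀ F → to γ F ≈ to δ F
    ; _∙_     = λ γ δ → record
      { to        = to δ ∘ to γ
      ; from      = from γ ∘ from δ
      ; to-mono   = to-mono δ ∘ to-mono γ
      ; from-mono = from-mono γ ∘ from-mono δ
      ; to-from   = λ F → Eq.trans (to-cong δ (to-from γ _)) (to-from δ F)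
      ; from-to   = λ F → Eq.trans (from-cong γ (from-to δ _)) (from-to γ F)
      }
    ; ε       = record
      { to = id ; from = id ; to-mono = id ; from-mono = id
      ; to-from = λ _ → Eq.refl ; from-to = λ _ → Eq.refl }
    ; _⁻¹     = λ γ → record
      { to = from γ ; from = to γ ; to-mono = from-mono γ ; from-mono = to-mono γ
      ; to-from = from-to γ ; from-to = to-from γ }
    ; isGroup = record
      { isMonoid = record
        { isSemigroup = record
          { isMagma = record
            { isEquivalence = record
              { refl  = λ _ → Eq.refl
              ; sym   = λ p F → Eq.sym (p F)
              ; trans = λ p q F → Eq.trans (p F) (q F)
              }
            ; ∙-cong = λ {γ} {γ′} {δ} p q F → Eq.trans (to-cong δ (p F)) (q (to γ′ F))
            }
          ; assoc = λ _ _ _ _ → Eq.refl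
          }
        ; identity = (λ _ _ → Eq.refl) , (λ _ _ → Eq.refl)
        }
      ; inverse = to-from , from-to
      ; ⁻¹-cong = λ {γ} {δ} p F → Eq.trans
          (from-cong γ (Eq.trans (Eq.sym (to-from δ F)) (Eq.sym (p (from δ F)))))
          (from-to γ (from δ F))
      }
    }

  infixl 7 _·_

  _·_ : Flag → Automorphism → Flag
  Φ · γ = record
    { face      = to γ ∘ face Φ
    ; face-rank = λ i → ≡.trans (rank-to γ (face Φ i)) (face-rank Φ i)
    ; face-mono = to-mono γ ∘ face-mono Φ
    }

  SameOrbit : Rel Flag (c ⊔ ℓ₁ ⊔ ℓ₂)
  SameOrbit Φ Ψ = ∃ λ γ → Φ · γ ≋ Ψ

  SameOrbit-sym : ∀ Φ Ψ → SameOrbit Φ Ψ → SameOrbit Ψ Φ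
  SameOrbit-sym Φ Ψ (γ , e) = Group._⁻¹ Γ γ ,
    λ i → Eq.trans (from-cong γ (Eq.sym (e i))) (from-to γ _)

  SameOrbit-trans : ∀ Φ Ψ Θ → SameOrbit Φ Ψ → SameOrbit Ψ Θ → SameOrbit Φ Θ
  SameOrbit-trans Φ Ψ Θ (γ , e) (δ , e′) = Group._∙_ Γ γ δ ,
    λ i → Eq.trans (to-cong δ (e i)) (e′ i)

  record IsChiral : Set (c ⊔ ℓ₁ ⊔ ℓ₂) where
    field
      rep₁ rep₂  : Flag
      two-orbits : ¬ SameOrbit rep₁ rep₂
      only-two   : ∀ Φ → SameOrbit rep₁ Φ ⊎ SameOrbit rep₂ Φ
      separated  : ∀ Φ Ψ → Adjacent Φ Ψ → ¬ SameOrbit Φ Ψ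

    same : ∀ Ω {Φ Ψ} → SameOrbit Ω Φ → SameOrbit Ω Ψ → SameOrbit Φ Ψ
    same Ω {Φ} {Ψ} p q = SameOrbit-trans Φ Ω Ψ (SameOrbit-sym Ω Φ p) q

    even : ∀ Φ Ψ Θ → Adjacent Φ Ψ → Adjacent Ψ Θ → SameOrbit Φ Θ
    even Φ Ψ Θ ΦΨ ΨΘ with only-two Φ | only-two Ψ | only-two Θ
    ... | inj₁ p | _      | inj₁ r = same rep₁ {Φ} {Θ} p r
    ... | inj₂ p | _      | inj₂ r = same rep₂ {Φ} {Θ} p r
    ... | inj₁ p | inj₁ q | inj₂ _ = contradiction (same rep₁ {Φ} {Ψ} p q) (separated Φ Ψ ΦΨ)
    ... | inj₂ p | inj₂ q | inj₁ _ = contradiction (same rep₂ {Φ} {Ψ} p q) (separated Φ Ψ ΦΨ)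
    ... | inj₁ _ | inj₂ q | inj₂ r = contradiction (same rep₂ {Ψ} {Θ} q r) (separated Ψ Θ ΨΘ)
    ... | inj₂ _ | inj₁ q | inj₁ r = contradiction (same rep₁ {Ψ} {Θ} q r) (separated Ψ Θ ΨΘ)

module _ (P : Polytope n c ℓ₁ ℓ₂) where
  private module P = Polytope P

  dualRankedPoset : RankedPoset n c ℓ₁ ℓ₂
  dualRankedPoset = record
    { poset       = PosetProperties.≥-poset P.poset
    ; rank        = opposite ∘ P.rank
    ; rank-mono   = opposite-antitone ∘ P.rank-mono
    ; rank-strict = λ G≤F e → P.Eq.sym (P.rank-strict G≤F (≡.sym
        (≡.trans (≡.sym (opposite-involutive _)) (≡.trans (≡.cong opposite e) (opposite-involutive _)))))
    }

  private module D = RankedPoset dualRankedPoset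

  undualFlag : D.Flag → P.Flag
  undualFlag Φ = record
    { face      = D.face Φ ∘ opposite
    ; face-rank = λ i → ≡.trans (≡.sym (opposite-involutive _))
        (≡.trans (≡.cong opposite (D.face-rank Φ (opposite i))) (opposite-involutive i))
    ; face-mono = D.face-mono Φ ∘ opposite-antitone
    }

  dualFlag : Polytope.Flag P → RankedPoset.Flag dualRankedPoset
  dualFlag Φ = record
    { face      = P.face Φ ∘ opposite
    ; face-rank = λ i → ≡.trans (≡.cong opposite (P.face-rank Φ (opposite i))) (opposite-involutive i)
    ; face-mono = P.face-mono Φ ∘ opposite-antitone
    }

  module _ (Φ : P.Flag) where
    ∈-dual : ∀ {F} → F P.∈ Φ → F D.∈ dualFlag Φ
    ∈-dual {F} (i , e) = opposite i , ≡.subst (λ x → P.face Φ x P.≈ F) (≡.sym (opposite-involutive i)) e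

  ∈-undual : ∀ (Φ : D.Flag) {F} → F D.∈ Φ → F P.∈ undualFlag Φ
  ∈-undual Φ {F} (i , e) = opposite i , ≡.subst (λ x → D.face Φ x P.≈ F) (≡.sym (opposite-involutive i)) e

  ∉-opposite : {i j : Fin (suc (suc n))} → i ≢ opposite j → opposite i ≢ j
  ∉-opposite i≢ ≡.refl = i≢ (≡.sym (opposite-involutive _))

  adjacent-dual : ∀ {Φ Ψ} → P.Adjacent Φ Ψ → D.Adjacent (dualFlag Φ) (dualFlag Ψ)
  adjacent-dual {Φ} {Ψ} (j , ≉ , agrees) = opposite j ,
    ≡.subst (λ x → ¬ P.face Φ x P.≈ P.face Ψ x) (≡.sym (opposite-involutive j)) ≉ ,
    λ i i≢ → agrees (opposite i) (∉-opposite i≢)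

  adjacent-undual : ∀ {Φ Ψ} → D.Adjacent Φ Ψ → P.Adjacent (undualFlag Φ) (undualFlag Ψ)
  adjacent-undual {Φ} {Ψ} (j , ≉ , agrees) = opposite j ,
    ≡.subst (λ x → ¬ D.face Φ x P.≈ D.face Ψ x) (≡.sym (opposite-involutive j)) ≉ ,
    λ i i≢ → agrees (opposite i) (∉-opposite i≢)

  dual-undual : ∀ Φ → dualFlag (undualFlag Φ) D.≋ Φ
  dual-undual Φ i = P.Eq.reflexive (≡.cong (D.face Φ) (opposite-involutive i))

  <-swap : ∀ {F G} → F P.< G → G D.< F
  <-swap (F≤G , F≉G) = F≤G , F≉G ∘ P.Eq.sym

  <-unswap : ∀ {F G} → G D.< F → F P.< G
  <-unswap (F≤G , G≉F) = F≤G , G≉F ∘ P.Eq.sym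

  unshift : ∀ d (i j : Fin (suc (suc n))) →
            toℕ (opposite j) ≡ d ℕ.+ toℕ (opposite i) → toℕ i ≡ d ℕ.+ toℕ j
  unshift d i j e = ≡.subst₂ (λ x y → toℕ x ≡ d ℕ.+ toℕ y)
    (opposite-involutive i) (opposite-involutive j) (opposite-shift d (opposite i) (opposite j) e)

  middle : ∀ {x y z} → x ≡ 2 ℕ.+ y → z ≡ 1 ℕ.+ y → x ≡ 1 ℕ.+ z
  middle ≡.refl ≡.refl = ≡.refl

  middle′ : ∀ {x y z} → x ≡ 2 ℕ.+ y → x ≡ 1 ℕ.+ z → z ≡ 1 ℕ.+ y
  middle′ ≡.refl ≡.refl = ≡.refl

  above-dual : ∀ Φ Ψ {Θ Θ′} → P.AdjacentAbove (undualFlag Φ) (undualFlag Ψ) Θ Θ′ →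
               D.AdjacentAbove Φ Ψ (dualFlag Θ) (dualFlag Θ′)
  above-dual Φ Ψ {Θ} {Θ′} (adj , above) = adjacent-dual {Θ} {Θ′} adj ,
    λ F∈Φ F∈Ψ → ∈-dual Θ′ (above (∈-undual Φ F∈Φ) (∈-undual Ψ F∈Ψ))

  adjacent-respˡ : ∀ {Φ Φ′ Ψ} → Φ D.≋ Φ′ → D.Adjacent Φ Ψ → D.Adjacent Φ′ Ψ
  adjacent-respˡ e (j , ≉ , agrees) =
    j , ≉ ∘ D.Eq.trans (e j) , λ i i≢ → D.Eq.trans (D.Eq.sym (e i)) (agrees i i≢)

  ≋-dual : ∀ {Θ} Ψ → Θ P.≋ undualFlag Ψ → dualFlag Θ D.≋ Ψ
  ≋-dual Ψ e i = P.Eq.trans (e (opposite i)) (dual-undual Ψ i)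

  connected-dual : ∀ Φ Ψ →
    (∃ λ Θ → Star (P.AdjacentAbove (undualFlag Φ) (undualFlag Ψ)) (undualFlag Φ) Θ ∧ Θ P.≋ undualFlag Ψ) →
    ∃ λ Θ → Star (D.AdjacentAbove Φ Ψ) Φ Θ ∧ Θ D.≋ Ψ
  connected-dual Φ Ψ (_ , Star.ε , e) =
    Φ , Star.ε , λ i → D.Eq.trans (D.Eq.sym (dual-undual Φ i)) (≋-dual {undualFlag Φ} Ψ e i)
  connected-dual Φ Ψ (Θ , _◅_ {j = Φ′} step path , e) = dualFlag Θ ,
    Prod.map₁ (adjacent-respˡ {dualFlag (undualFlag Φ)} {Φ} {dualFlag Φ′} (dual-undual Φ))
      (above-dual Φ Ψ {undualFlag Φ} {Φ′} step)
      ◅ Star.gmap dualFlag (λ {Θ} {Θ′} → above-dual Φ Ψ {Θ} {Θ′}) path ,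
    ≋-dual {Θ} Ψ e

  dual : Polytope n c ℓ₁ ℓ₂
  dual = record
    { rankedPoset = dualRankedPoset
    ; least       = let F , r , max = P.greatest in
        F , ≡.trans (≡.cong opposite r) (opposite-involutive zero) , max
    ; greatest    = let F , r , min = P.least in
        F , ≡.cong opposite r , min
    ; flagged     = λ Fs chain →
        let Φ , Fs⊆Φ = P.flagged Fs (AllPairs.map Sum.swap chain) in
        dualFlag Φ , All.map (∈-dual Φ) Fs⊆Φ
    ; diamond     = λ F H F<H e →
        let e′ = unshift 2 (P.rank F) (P.rank H) e
            module T = P.ExactlyTwo (P.diamond H F (<-unswap F<H) e′)
            dualise : ∀ {G} → P.Between H F G → D.Between F H G
            dualise {G} (H<G , G<F , r) = <-swap G<F , <-swap H<G ,
              opposite-shift 1 (P.rank G) (P.rank F) (middle e′ r)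
            undualise : ∀ {G} → D.Between F H G → P.Between H F G
            undualise {G} (F<G , G<H , r) = <-unswap G<H , <-unswap F<G ,
              middle′ e′ (unshift 1 (P.rank F) (P.rank G) r)
        in record
          { fst = T.fst ; snd = T.snd ; fst∈ = dualise T.fst∈ ; snd∈ = dualise T.snd∈
          ; distinct = T.distinct ; only = λ G → T.only G ∘ undualise }
    ; connected   = λ Φ Ψ → connected-dual Φ Ψ (P.connected (undualFlag Φ) (undualFlag Ψ))
    }

  private module P^δ = Polytope dual

  dualAutomorphism : P.Automorphism → P^δ.Automorphism
  dualAutomorphism γ = record
    { to = to ; from = from ; to-mono = to-mono ; from-mono = from-mono ; to-from = to-from ; from-to = from-to }
    where open P.Automorphism γ

  undualAutomorphism : P^δ.Automorphism → P.Automorphism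
  undualAutomorphism γ = record
    { to = to ; from = from ; to-mono = to-mono ; from-mono = from-mono ; to-from = to-from ; from-to = from-to }
    where open P^δ.Automorphism γ

  dual-orbit : ∀ Φ Ψ → P.SameOrbit Φ (undualFlag Ψ) → P^δ.SameOrbit (dualFlag Φ) Ψ
  dual-orbit Φ Ψ (γ , e) = dualAutomorphism γ ,
    λ i → P.Eq.trans (e (opposite i)) (dual-undual Ψ i)

  undual-orbit : ∀ {Φ Ψ} → P^δ.SameOrbit Φ Ψ → P.SameOrbit (undualFlag Φ) (undualFlag Ψ)
  undual-orbit (γ , e) = undualAutomorphism γ , e ∘ opposite

  undual-orbit′ : ∀ {Φ Ψ} → P^δ.SameOrbit (dualFlag Φ) (dualFlag Ψ) → P.SameOrbit Φ Ψ
  undual-orbit′ {Φ} {Ψ} (γ , e) = undualAutomorphism γ , λ i →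
    ≡.subst (λ x → P^δ.Automorphism.to γ (P.face Φ x) P.≈ P.face Ψ x) (opposite-involutive i) (e (opposite i))

  dual-isChiral : P.IsChiral → P^δ.IsChiral
  dual-isChiral χ = record
    { rep₁       = dualFlag rep₁
    ; rep₂       = dualFlag rep₂
    ; two-orbits = two-orbits ∘ undual-orbit′ {rep₁} {rep₂}
    ; only-two   = λ Φ → Sum.map (dual-orbit rep₁ Φ) (dual-orbit rep₂ Φ) (only-two (undualFlag Φ))
    ; separated  = λ Φ Ψ adj orb → separated (undualFlag Φ) (undualFlag Ψ)
        (adjacent-undual {Φ} {Ψ} adj) (undual-orbit {Φ} {Ψ} orb)
    }
    where open P.IsChiral χ

data Word (X : Set) : Set where
  gen : X → Word X
  ε   : Word X
  _∙_ : Word X → Word X → Word X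
  _⁻¹ : Word X → Word X

infixl 7 _∙_
infix  8 _⁻¹

power : ℕ → Word X → Word X
power zero    w = ε
power (suc q) w = w ∙ power q w

extend : (X → Word Y) → Word X → Word Y
extend f (gen x) = f x
extend f ε       = ε
extend f (v ∙ w) = extend f v ∙ extend f w
extend f (w ⁻¹)  = extend f w ⁻¹

mapWord : (X → Y) → Word X → Word Y
mapWord f = extend (gen ∘ f)

module _ (G : Group a ℓ) where
  open Group G renaming (ε to ε′; _∙_ to _∙′_; _⁻¹ to _⁻¹′)

  eval : (X → Carrier) → Word X → Carrier
  eval ρ (gen x) = ρ x
  eval ρ ε       = ε′
  eval ρ (v ∙ w) = eval ρ v ∙′ eval ρ w
  eval ρ (w ⁻¹)  = eval ρ w ⁻¹′

Presentation : Set → Set₁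
Presentation X = Pred (Word X) 0ℓ

infix 4 _⊢_≈_

data _⊢_≈_ {X : Set} (R : Presentation X) : Rel (Word X) 0ℓ where
  relator   : ∀ {w} → R w → R ⊢ w ≈ ε
  refl      : ∀ {w} → R ⊢ w ≈ w
  sym       : ∀ {v w} → R ⊢ v ≈ w → R ⊢ w ≈ v
  trans     : ∀ {u v w} → R ⊢ u ≈ v → R ⊢ v ≈ w → R ⊢ u ≈ w
  ∙-cong    : ∀ {u v w x} → R ⊢ u ≈ v → R ⊢ w ≈ x → R ⊢ u ∙ w ≈ v ∙ x
  ⁻¹-cong   : ∀ {v w} → R ⊢ v ≈ w → R ⊢ v ⁻¹ ≈ w ⁻¹
  assoc     : ∀ u v w → R ⊢ (u ∙ v) ∙ w ≈ u ∙ (v ∙ w)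
  identityˡ : ∀ w → R ⊢ ε ∙ w ≈ w
  identityʳ : ∀ w → R ⊢ w ∙ ε ≈ w
  inverseˡ  : ∀ w → R ⊢ w ⁻¹ ∙ w ≈ ε
  inverseʳ  : ∀ w → R ⊢ w ∙ w ⁻¹ ≈ ε

⟪_⟫ : Presentation X → Group 0ℓ 0ℓ
⟪_⟫ {X} R = record
  { Carrier = Word X
  ; _≈_     = R ⊢_≈_
  ; _∙_     = _∙_
  ; ε       = ε
  ; _⁻¹     = _⁻¹
  ; isGroup = record
    { isMonoid = record
      { isSemigroup = record
        { isMagma = record
          { isEquivalence = record { refl = refl ; sym = sym ; trans = trans }
          ; ∙-cong        = ∙-cong
          }
        ; assoc = assoc
        }
      ; identity = identityˡ , identityʳ
      }
    ; inverse = inverseˡ , inverseʳ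
    ; ⁻¹-cong = ⁻¹-cong
    }
  }

data Comix {X : Set} (R S : Presentation X) : Presentation (X ⊎ X) where
  left     : ∀ {w} → R w → Comix R S (mapWord inj₁ w)
  right    : ∀ {w} → S w → Comix R S (mapWord inj₂ w)
  identify : ∀ x → Comix R S (gen (inj₁ x) ⁻¹ ∙ gen (inj₂ x))

infixr 6 _□_

_□_ : Presentation X → Presentation X → Group 0ℓ 0ℓ
R □ S = ⟪ Comix R S ⟫

-- `segment σ i j` is σᵢ σᵢ₊₁ ⋯ σⱼ, for i ≤ j.
prefix : (Fin m → Word X) → Fin m → Word X
prefix σ zero    = σ zero
prefix σ (suc j) = σ zero ∙ prefix (σ ∘ suc) j

segment : (Fin m → Word X) → Fin m → Fin m → Word X
segment σ zero    j       = prefix σ j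
segment σ (suc i) (suc j) = segment (σ ∘ suc) i j
segment σ (suc i) zero    = ε

data ℕ∞ : Set where
  fin : ℕ → ℕ∞
  ∞   : ℕ∞

-- Throughout, the index i : Fin m stands for the generator σ_{i+1} of a
-- polytope of rank n = m + 1.
data W⁺ {m} : Presentation (Fin m) where
  squared : ∀ {i j} → i Fin.< j → W⁺ (power 2 (segment gen i j))

data [_]⁺ {m} (p : Fin m → ℕ∞) : Presentation (Fin m) where
  powered : ∀ {i q} → p i ≡ fin q → [ p ]⁺ (power q (gen i))
  squared : ∀ {i j} → i Fin.< j → [ p ]⁺ (power 2 (segment gen i j))

-- A group with a specified k-tuple of elements.  That the tuple generates is
-- not recorded; nothing below depends on it.
record Marked (k : ℕ) (a ℓ : Level) : Set (lsuc (a ⊔ ℓ)) where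
  field
    group     : Group a ℓ
    generator : Fin k → Group.Carrier group

  open Group group public

  ⟦_⟧ : Word (Fin k) → Carrier
  ⟦_⟧ = eval group generator

infixr 6 _⋄_

_⋄_ : Marked k a ℓ → Marked k b ℓ′ → Marked k (a ⊔ b ⊔ ℓ ⊔ ℓ′) (ℓ ⊔ ℓ′)
_⋄_ {k} G H = record
  { group     = record
    { Carrier = Σ GH.Carrier λ x → ∃ λ w → value w GH.≈ x
    ; _≈_     = λ x y → proj₁ x GH.≈ proj₁ y
    ; _∙_     = λ (x , v , p) (y , w , q) → x GH.∙ y , v ∙ w , GH.∙-cong p q
    ; ε       = GH.ε , ε , GH.refl
    ; _⁻¹     = λ (x , w , p) → x GH.⁻¹ , w ⁻¹ , GH.⁻¹-cong p
    ; isGroup = record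
      { isMonoid = record
        { isSemigroup = record
          { isMagma = record
            { isEquivalence = record { refl = GH.refl ; sym = GH.sym ; trans = GH.trans }
            ; ∙-cong        = GH.∙-cong
            }
          ; assoc = λ x y z → GH.assoc (proj₁ x) (proj₁ y) (proj₁ z)
          }
        ; identity = GH.identityˡ ∘ proj₁ , GH.identityʳ ∘ proj₁
        }
      ; inverse = GH.inverseˡ ∘ proj₁ , GH.inverseʳ ∘ proj₁
      ; ⁻¹-cong = GH.⁻¹-cong
      }
    }
  ; generator = λ i → pair i , gen i , GH.refl
  }
  where
  module GH = Group (Product.group (Marked.group G) (Marked.group H))

  pair : Fin k → GH.Carrier
  pair i = Marked.generator G i , Marked.generator H i

  value : Word (Fin k) → GH.Carrier
  value = eval (Product.group (Marked.group G) (Marked.group H)) pair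

HasCardinality : Group a ℓ → ℕ → Set (a ⊔ ℓ)
HasCardinality G N = Inverse (Group.setoid G) (≡.setoid (Fin N))

-- The library's `q × x` is additive notation for the power x^q.
module _ (G : Group a ℓ) where
  open Group G renaming (ε to ε′)

  HasOrder : Carrier → ℕ∞ → Set ℓ
  HasOrder x (fin q) = 0 ℕ.< q ∧ (_×_ rawMonoid q x ≈ ε′) ∧
                       (∀ r → 0 ℕ.< r → r ℕ.< q → ¬ _×_ rawMonoid r x ≈ ε′)
  HasOrder x ∞       = ∀ r → 0 ℕ.< r → ¬ _×_ rawMonoid r x ≈ ε′

Kernel : Marked k a ℓ → Pred (Word (Fin k)) ℓ
Kernel G w = ⟦ w ⟧ ≈ Marked.ε G
  where open Marked G using (⟦_⟧; _≈_)

mirrorGenerator : Fin m → Word (Fin m)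
mirrorGenerator zero          = gen zero ⁻¹
mirrorGenerator (suc zero)    = gen zero ∙ gen zero ∙ gen (suc zero)
mirrorGenerator (suc (suc j)) = gen (suc (suc j))

mirrorWord : Word (Fin m) → Word (Fin m)
mirrorWord = extend mirrorGenerator

-- The image, in the group W⁺, of a set of words under w ↦ w̄.
Mirrored : Pred (Word (Fin m)) ℓ → Pred (Word (Fin m)) ℓ
Mirrored N w = ∃ λ v → N v ∧ W⁺ ⊢ w ≈ mirrorWord v

record ChiralPolytope (n : ℕ) (c ℓ₁ ℓ₂ : Level) : Set (lsuc (c ⊔ ℓ₁ ⊔ ℓ₂)) where
  field
    polytope : Polytope n c ℓ₁ ℓ₂
    base     : Polytope.Flag polytope
    isChiral : Polytope.IsChiral polytope

mirror : ChiralPolytope (suc m) c ℓ₁ ℓ₂ → ChiralPolytope (suc m) c ℓ₁ ℓ₂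
mirror 𝒫 = record { polytope = polytope ; base = base ^ zero ; isChiral = isChiral }
  where
  open ChiralPolytope 𝒫
  open Polytope polytope using (_^_)

_ᵟ : ChiralPolytope n c ℓ₁ ℓ₂ → ChiralPolytope n c ℓ₁ ℓ₂
𝒫 ᵟ = record
  { polytope = dual polytope ; base = dualFlag polytope base ; isChiral = dual-isChiral polytope isChiral }
  where open ChiralPolytope 𝒫

module _ (𝒫 : ChiralPolytope (suc m) c ℓ₁ ℓ₂) where
  open ChiralPolytope 𝒫
  open Polytope polytope using (Automorphism; SameOrbit; _·_; _≋_; _^_; ^-differs; Γ)

  σ-exists : (i : Fin m) → SameOrbit base (base ^ suc i ^ inject₁ i)
  σ-exists i = Polytope.IsChiral.even isChiral
    base (base ^ suc i) (base ^ suc i ^ inject₁ i)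
    (_ , ^-differs base (suc i)) (_ , ^-differs (base ^ suc i) (inject₁ i))

  σ : Fin m → Automorphism
  σ i = proj₁ (σ-exists i)

  σ-base : (i : Fin m) → base · σ i ≋ base ^ suc i ^ inject₁ i
  σ-base i = proj₂ (σ-exists i)

  Γ⁺ : Marked m (c ⊔ ℓ₁ ⊔ ℓ₂) (c ⊔ ℓ₁)
  Γ⁺ = record { group = Γ ; generator = σ }

  HasType : (Fin m → ℕ∞) → Set (c ⊔ ℓ₁)
  HasType p = ∀ i → HasOrder Γ (σ i) (p i)

-- Chirality of the pre-polytope 𝒫 ⋄ 𝒬, with Γ⁺(𝒫 ⋄ 𝒬) = Γ⁺(𝒫) ⋄ Γ⁺(𝒬) = W⁺/N.
MixIsChiral : ChiralPolytope (suc m) c ℓ₁ ℓ₂ → ChiralPolytope (suc m) c ℓ₁ ℓ₂ → Set (c ⊔ ℓ₁)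
MixIsChiral 𝒫 𝒬 = ¬ (Mirrored N ≐ N)
  where N = Kernel (Γ⁺ 𝒫 ⋄ Γ⁺ 𝒬)

{-# OPTIONS --safe #-}
module Submission where

open import Level using (Level; _⊔_)
open import Algebra.Bundles using (Group)
import Algebra.Construct.DirectProduct as Product
import Algebra.Properties.Group as GroupProperties
import Algebra.Properties.Monoid.Mult as Mult
open import Data.Fin.Base as Fin using (Fin; zero; suc; opposite; toℕ; fromℕ; inject₁; combine; remQuot)
import Data.Fin.Properties as Finₚ
open import Data.Fin.Relation.Unary.Top using (view; ‵fromℕ; ‵inject₁)
open import Data.Integer.Base as ℤ using (+_)
import Data.Integer.Properties as ℤₚ
open import Data.List.Base using ([]; _∷_)
open import Data.List.Relation.Unary.All using ([]; _∷_)
open import Data.List.Relation.Unary.AllPairs using ([]; _∷_)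
open import Data.Nat.Base as ℕ using (ℕ; zero; suc; s≤s; NonZero)
import Data.Nat.Properties as ℕₚ
open import Data.Product.Base using (∃; _×_; _,_; proj₁; proj₂)
open import Data.Rational.Base using (_/_; _*_; _>_)
import Data.Rational.Properties as ℚₚ
import Data.Rational.Unnormalised.Base as ℚᵘ
import Data.Rational.Unnormalised.Properties as ℚᵘₚ
open import Data.Sum.Base using (_⊎_; inj₁; inj₂; [_,_])
open import Function.Base using (_∘_; id)
open import Function.Bundles using (Inverse; Equivalence; _⇔_; mk⇔)
import Function.Properties.Equivalence as ⇔
open import Relation.Binary.Bundles using (Setoid)
open import Relation.Binary.Construct.Closure.ReflexiveTransitive using (Star; _◅_) renaming (ε to [])
import Relation.Binary.Properties.Poset as PosetProperties
open import Relation.Binary.PropositionalEquality as ≡ using (_≡_; _≢_)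
import Relation.Binary.Reasoning.Setoid as SetoidReasoning
open import Relation.Nullary using (¬_; yes; no; contradiction)
open import Relation.Unary using (_⊆_)
open import Defs

-- Write W⁺/M, W⁺/M̄, W⁺/D, W⁺/D̄ for the groups of 𝒫, its mirror image, its dual
-- and the mirror image of its dual; put A = M ∩ M̄ and B = D ∩ D̄.  All relators
-- of the comix lie in AB: 𝒫 and its mirror image have type p, the two duals have
-- the reversed type.  Suppose that 𝒫 ⋄ 𝒫ᵟ is not chiral.  Then M ∩ D is invariant
-- under w ↦ w̄, hence M ∩ D ⊆ A ∩ B, and this makes the map
--   (aA , bB) ↦ (a⁻¹b in the comix , aM , bD)
-- on fixed representatives injective: if a⁻¹b and a′⁻¹b′ agree in the comix, then
-- some w satisfies aw = b modulo A and a′w = b′ modulo B, so that a′w = b modulo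
-- M ∩ D.  As δ carries A to B, comparing sizes gives mix² ≤ comix · ∣Γ⁺(𝒫)∣².

-- Flags: the exchanges Φ ↦ Φ ^ j and the rigidity of automorphisms.

module Flags {n c ℓ₁ ℓ₂} (P : Polytope n c ℓ₁ ℓ₂) where
  open Polytope P hiding (refl; trans)
  open Automorphism
  private module Γ = Group Γ

  infix 4 _≃_

  -- Φ ≋ Ψ as a record, so that the flags can be inferred from a proof.
  record _≃_ (Φ Ψ : Flag) : Set ℓ₁ where
    constructor ⟨_⟩
    field faces : Φ ≋ Ψ

  open _≃_ public

  ≃-setoid : Setoid _ _
  ≃-setoid = record
    { Carrier       = Flag
    ; _≈_           = _≃_
    ; isEquivalence = record
      { refl  = ⟨ (λ _ → Eq.refl) ⟩
      ; sym   = λ e → ⟨ (λ i → Eq.sym (faces e i)) ⟩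
      ; trans = λ e e′ → ⟨ (λ i → Eq.trans (faces e i) (faces e′ i)) ⟩
      }
    }

  module ≃ = Setoid ≃-setoid
  open SetoidReasoning ≃-setoid

  AgreeAround : Fin n → Flag → Flag → Set ℓ₁
  AgreeAround j Φ Ψ = face Φ (below j) ≈ face Ψ (below j)
                    × face Φ (at j)    ≈ face Ψ (at j)
                    × face Φ (above j) ≈ face Ψ (above j)

  below≢at : ∀ j → below j ≢ at j
  below≢at j = Finₚ.<⇒≢ (below<at j)

  above≢at : ∀ j → above j ≢ at j
  above≢at j = Finₚ.<⇒≢ (at<above j) ∘ ≡.sym

  between-resp : ∀ {F F′ H H′ G} → F ≈ F′ → H ≈ H′ → Between F H G → Between F′ H′ G
  between-resp F≈ H≈ (F<G , G<H , r) =
    PosetProperties.<-respˡ-≈ poset F≈ F<G ,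
    PosetProperties.<-respʳ-≈ poset H≈ G<H ,
    ≡.trans r (≡.cong (suc ∘ toℕ) (rank-cong F≈))

  different⇒between : ∀ {j Φ Ψ} → DifferExactlyAt (at j) Φ Ψ →
                      Between (face Φ (below j)) (face Φ (above j)) (face Ψ (at j))
  different⇒between {j} {Φ} {Ψ} (_ , agree) = between-resp
    (Eq.sym (agree _ (below≢at j))) (Eq.sym (agree _ (above≢at j))) (face-between Ψ j)

  others-agree : ∀ {p} {Q : Face → Set p} → ExactlyTwo Q → ∀ {F G H} →
                 Q F → Q G → Q H → ¬ F ≈ G → ¬ F ≈ H → G ≈ H
  others-agree two {F} {G} {H} QF QG QH F≉G F≉H with only F QF | only G QG | only H QH
    where open ExactlyTwo two
  ... | inj₁ f | inj₁ g | _      = contradiction (Eq.trans f (Eq.sym g)) F≉G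
  ... | inj₂ f | inj₂ g | _      = contradiction (Eq.trans f (Eq.sym g)) F≉G
  ... | inj₁ f | _      | inj₁ h = contradiction (Eq.trans f (Eq.sym h)) F≉H
  ... | inj₂ f | _      | inj₂ h = contradiction (Eq.trans f (Eq.sym h)) F≉H
  ... | inj₁ _ | inj₂ g | inj₂ h = Eq.trans g (Eq.sym h)
  ... | inj₂ _ | inj₁ g | inj₁ h = Eq.trans g (Eq.sym h)

  -- By the diamond condition the new face is the other face of a two-face section, and that section
  -- is fixed by the faces just below and just above.
  replaced-face-local : ∀ {j Φ Φ′ Ψ Ψ′} → AgreeAround j Φ Ψ →
    DifferExactlyAt (at j) Φ Φ′ → DifferExactlyAt (at j) Ψ Ψ′ → face Φ′ (at j) ≈ face Ψ′ (at j)
  replaced-face-local {j} {Φ} {Φ′} {Ψ} {Ψ′} (b , a , t) d d′ = others-agree (section Φ j)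
    (face-between Φ j) (different⇒between {j} {Φ} {Φ′} d)
    (between-resp (Eq.sym b) (Eq.sym t) (different⇒between {j} {Ψ} {Ψ′} d′))
    (proj₁ d) (proj₁ d′ ∘ Eq.trans (Eq.sym a))

  -- Characterises `_^_` without unfolding its case split; identities between exchanges then reduce
  -- to checking where two flags differ.
  ^-unique : ∀ {j Φ Ψ Θ} → Φ ≃ Ψ → DifferExactlyAt (at j) Φ Θ → Θ ≃ Ψ ^ j
  ^-unique {j} {Φ} {Ψ} {Θ} e d = ⟨ agree ⟩
    where
    agree : Θ ≋ Ψ ^ j
    agree i with i Finₚ.≟ at j
    ... | yes ≡.refl = replaced-face-local {j} {Φ} {Θ} {Ψ} {Ψ ^ j}
                         (faces e _ , faces e _ , faces e _) d (^-differs Ψ j)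
    ... | no i≢      = Eq.trans (Eq.sym (proj₂ d i i≢))
                         (Eq.trans (faces e i) (proj₂ (^-differs Ψ j) i i≢))

  ^-cong : ∀ {Φ Ψ} j → Φ ≃ Ψ → Φ ^ j ≃ Ψ ^ j
  ^-cong {Φ} j e = ^-unique e (^-differs Φ j)

  ^-involutive : ∀ Φ j → Φ ^ j ^ j ≃ Φ
  ^-involutive Φ j = ≃.sym (^-unique ≃.refl
    (proj₁ (^-differs Φ j) ∘ Eq.sym , λ i i≢ → Eq.sym (proj₂ (^-differs Φ j) i i≢)))

  ^-fixes : ∀ Φ j {i} → toℕ i ≢ suc (toℕ j) → face (Φ ^ j) i ≈ face Φ i
  ^-fixes Φ j i≢ = Eq.sym (proj₂ (^-differs Φ j) _ λ { ≡.refl → i≢ (toℕ-at j) })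

  -- As indices of a flag, `below j`, `at j` and `above j` are j, j + 1 and j + 2, while `at i` is i
  -- + 1; the three inequalities keep the exchanged index away from all of them.
  ^-agreeAround : ∀ Φ i j → toℕ j ≢ suc (toℕ i) → toℕ j ≢ toℕ i → suc (toℕ j) ≢ toℕ i →
                  AgreeAround j (Φ ^ i) Φ
  ^-agreeAround Φ i j b a t =
    ^-fixes Φ i (b ∘ ≡.trans (≡.sym (toℕ-below j))) ,
    ^-fixes Φ i (a ∘ ℕₚ.suc-injective ∘ ≡.trans (≡.sym (toℕ-at j))) ,
    ^-fixes Φ i (t ∘ ℕₚ.suc-injective)

  -- At ranks two or more apart, neither exchange touches the faces around the other rank, so each
  -- yields the same new face before and after the other.
  ^-comm : ∀ Φ {i j} → suc (toℕ i) ℕ.< toℕ j → Φ ^ i ^ j ≃ Φ ^ j ^ i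
  ^-comm Φ {i} {j} i+1<j = ⟨ agree ⟩
    where
    i<j : toℕ i ℕ.< toℕ j
    i<j = ℕₚ.<-trans (ℕₚ.n<1+n _) i+1<j

    at-i≢at-j : at i ≢ at j
    at-i≢at-j e = ℕₚ.<⇒≢ i<j (ℕₚ.suc-injective
      (≡.trans (≡.sym (toℕ-at i)) (≡.trans (≡.cong toℕ e) (toℕ-at j))))

    agree : Φ ^ i ^ j ≋ Φ ^ j ^ i
    agree k with k Finₚ.≟ at i | k Finₚ.≟ at j
    ... | yes ≡.refl | _ = Eq.trans
      (Eq.sym (proj₂ (^-differs (Φ ^ i) j) _ at-i≢at-j))
      (Eq.sym (replaced-face-local {i} {Φ ^ j} {Φ ^ j ^ i} {Φ} {Φ ^ i}
        (^-agreeAround Φ j i (ℕₚ.<⇒≢ (ℕₚ.m<n⇒m<1+n i<j)) (ℕₚ.<⇒≢ i<j) (ℕₚ.<⇒≢ i+1<j))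
        (^-differs (Φ ^ j) i) (^-differs Φ i)))
    ... | no k≢i | yes ≡.refl = Eq.trans
      (replaced-face-local {j} {Φ ^ i} {Φ ^ i ^ j} {Φ} {Φ ^ j}
        (^-agreeAround Φ i j (ℕₚ.>⇒≢ i+1<j) (ℕₚ.>⇒≢ i<j) (ℕₚ.>⇒≢ (ℕₚ.m<n⇒m<1+n i<j)))
        (^-differs (Φ ^ i) j) (^-differs Φ j))
      (proj₂ (^-differs (Φ ^ j) i) _ k≢i)
    ... | no k≢i | no k≢j = Eq.trans
      (Eq.sym (Eq.trans (proj₂ (^-differs Φ i) k k≢i) (proj₂ (^-differs (Φ ^ i) j) k k≢j)))
      (Eq.trans (proj₂ (^-differs Φ j) k k≢j) (proj₂ (^-differs (Φ ^ j) i) k k≢i))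

  ·-cong : ∀ {Φ Ψ} γ → Φ ≃ Ψ → Φ · γ ≃ Ψ · γ
  ·-cong γ e = ⟨ to-cong γ ∘ faces e ⟩

  -- An automorphism is injective on faces, so it carries flags differing exactly at `at j` to flags
  -- differing exactly there, and `^-unique` applies.
  ·-^ : ∀ Φ j γ → (Φ ^ j) · γ ≃ (Φ · γ) ^ j
  ·-^ Φ j γ = ^-unique ≃.refl
    ( (λ e → proj₁ (^-differs Φ j) (Eq.trans (Eq.sym (from-to γ _)) (Eq.trans (from-cong γ e) (from-to γ _))))
    , λ i i≢ → to-cong γ (proj₂ (^-differs Φ j) i i≢))

  ·-⁻¹ : ∀ {Φ Ψ} γ → Φ · γ ≃ Ψ → Ψ · (γ Γ.⁻¹) ≃ Φ
  ·-⁻¹ γ e = ⟨ (λ i → Eq.trans (from-cong γ (Eq.sym (faces e i))) (from-to γ _)) ⟩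

  -- The computing rule for products: since automorphisms commute with exchanges, those already made
  -- stay on the outside while γ acts on the flag within.
  ^^-· : ∀ {Φ Θ} γ i j → Φ · γ ≃ Θ → (Φ ^ i ^ j) · γ ≃ Θ ^ i ^ j
  ^^-· {Φ} {Θ} γ i j e = begin
    (Φ ^ i ^ j) · γ  ≈⟨ ·-^ (Φ ^ i) j γ ⟩
    (Φ ^ i · γ) ^ j  ≈⟨ ^-cong j (·-^ Φ i γ) ⟩
    (Φ · γ) ^ i ^ j  ≈⟨ ^-cong j (^-cong i e) ⟩
    Θ ^ i ^ j        ∎

  -- The least and greatest faces lie in every flag, so two flags can differ only at indices of the
  -- form `at j`.
  adjacent⇒^ : ∀ {Φ Ψ} → Adjacent Φ Ψ → ∃ λ j → Ψ ≃ Φ ^ j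
  adjacent⇒^ {Φ} {Ψ} (zero , ≉ , _) = contradiction
    (Eq.trans (Eq.sym (bottom Φ)) (bottom Ψ)) ≉
    where
    bottom : ∀ Θ → proj₁ least ≈ face Θ zero
    bottom Θ = rank-strict (proj₂ (proj₂ least) _)
      (≡.trans (proj₁ (proj₂ least)) (≡.sym (face-rank Θ zero)))
  adjacent⇒^ {Φ} {Ψ} (suc k , d) with view k
  ... | ‵inject₁ j = j , ^-unique ≃.refl d
  ... | ‵fromℕ     = contradiction (Eq.trans (top Φ) (Eq.sym (top Ψ))) (proj₁ d)
    where
    top : ∀ Θ → face Θ (fromℕ (suc n)) ≈ proj₁ greatest
    top Θ = rank-strict (proj₂ (proj₂ greatest) _)
      (≡.trans (face-rank Θ _) (≡.sym (proj₁ (proj₂ greatest))))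

  -- If γ and δ agree on Θ, then they agree on each Θ ^ j, because
  -- automorphisms commute with _^ j; hence on all flags, by connectedness.
  rigid : ∀ {Φ} γ δ → Φ · γ ≃ Φ · δ → γ Γ.≈ δ
  rigid {Φ} γ δ e F with flagged (F ∷ []) ([] ∷ [])
  ... | Ψ , (i , F∈Ψ) ∷ [] with connected Φ Ψ
  ... | Θ , path , Θ≋Ψ = transport F≈ (faces (along path e) i)
    where
    step : ∀ {Θ Θ′} → Adjacent Θ Θ′ → Θ · γ ≃ Θ · δ → Θ′ · γ ≃ Θ′ · δ
    step {Θ} {Θ′} adj e with adjacent⇒^ {Θ} {Θ′} adj
    ... | j , Θ′≃ = begin
      Θ′ · γ      ≈⟨ ·-cong γ Θ′≃ ⟩
      Θ ^ j · γ   ≈⟨ ·-^ Θ j γ ⟩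
      (Θ · γ) ^ j ≈⟨ ^-cong j e ⟩
      (Θ · δ) ^ j ≈⟨ ·-^ Θ j δ ⟨
      Θ ^ j · δ   ≈⟨ ·-cong δ Θ′≃ ⟨
      Θ′ · δ      ∎

    along : ∀ {Θ Θ′} → Star (AdjacentAbove Φ Ψ) Θ Θ′ → Θ · γ ≃ Θ · δ → Θ′ · γ ≃ Θ′ · δ
    along []                           e = e
    along (_◅_ {j = Ω} (adj , _) path) e = along path (step {_} {Ω} adj e)

    F≈ : face Θ i ≈ F
    F≈ = Eq.trans (Θ≋Ψ i) F∈Ψ

    transport : ∀ {G H} → G ≈ H → to γ G ≈ to δ G → to γ H ≈ to δ H
    transport G≈H e = Eq.trans (to-cong γ (Eq.sym G≈H)) (Eq.trans e (to-cong δ G≈H))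

-- Rotations at an arbitrary base flag, and the relations they satisfy.

module Rotations {m c ℓ₁ ℓ₂} (P : Polytope (suc m) c ℓ₁ ℓ₂) where
  open Polytope P hiding (refl; trans)
  open Flags P
  open SetoidReasoning ≃-setoid
  private module Γ = Group Γ

  -- The flag is a parameter because mirror images and duals change it. By rigidity such a family is
  -- unique up to equality in `Γ`.
  IsRotations : Flag → (Fin m → Automorphism) → Set ℓ₁
  IsRotations Ψ τ = ∀ i → Ψ · τ i ≃ Ψ ^ suc i ^ inject₁ i

  module _ {Ψ : Flag} {τ : Fin m → Automorphism} (rot : IsRotations Ψ τ) where

    inverse-rotation : ∀ i → Ψ · (τ i Γ.⁻¹) ≃ Ψ ^ inject₁ i ^ suc i
    inverse-rotation i = ·-⁻¹ (τ i) (begin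
      (Ψ ^ inject₁ i ^ suc i) · τ i               ≈⟨ ^^-· (τ i) _ _ (rot i) ⟩
      Ψ ^ suc i ^ inject₁ i ^ inject₁ i ^ suc i   ≈⟨ ^-cong _ (^-involutive _ _) ⟩
      Ψ ^ suc i ^ suc i                           ≈⟨ ^-involutive _ _ ⟩
      Ψ                                           ∎)

    IsRotations-resp-≃ : ∀ {Ψ′} → Ψ ≃ Ψ′ → IsRotations Ψ′ τ
    IsRotations-resp-≃ {Ψ′} e i = begin
      Ψ′ · τ i               ≈⟨ ·-cong (τ i) e ⟨
      Ψ · τ i                ≈⟨ rot i ⟩
      Ψ ^ suc i ^ inject₁ i  ≈⟨ ^-cong _ (^-cong _ e) ⟩
      Ψ′ ^ suc i ^ inject₁ i ∎

    -- Both sides take Ψ to Ψ′ ^ suc i ^ inject₁ i, so rigidity identifies them. Rotations at two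
    -- flags of one orbit are thus conjugate, here in a form free of inverses of γ.
    rotations-conjugate : ∀ {Ψ′ τ′} γ → Ψ · γ ≃ Ψ′ → IsRotations Ψ′ τ′ → ∀ i → τ i Γ.∙ γ Γ.≈ γ Γ.∙ τ′ i
    rotations-conjugate {Ψ′} {τ′} γ e rot′ i = rigid {Ψ} (τ i Γ.∙ γ) (γ Γ.∙ τ′ i) (begin
      Ψ · (τ i Γ.∙ γ)             ≈⟨ ⟨ (λ _ → Eq.refl) ⟩ ⟩
      (Ψ · τ i) · γ               ≈⟨ ·-cong γ (rot i) ⟩
      (Ψ ^ suc i ^ inject₁ i) · γ ≈⟨ ^^-· γ _ _ e ⟩
      Ψ′ ^ suc i ^ inject₁ i      ≈⟨ rot′ i ⟨
      Ψ′ · τ′ i                   ≈⟨ ·-cong (τ′ i) e ⟨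
      (Ψ · γ) · τ′ i              ≈⟨ ⟨ (λ _ → Eq.refl) ⟩ ⟩
      Ψ · (γ Γ.∙ τ′ i)            ∎)

    rotations-unique : ∀ {τ′} → IsRotations Ψ τ′ → ∀ i → τ i Γ.≈ τ′ i
    rotations-unique {τ′} rot′ i = rigid {Ψ} (τ i) (τ′ i) (≃.trans (rot i) (≃.sym (rot′ i)))

    -- Moving the base flag from Ψ ^ 0 to Ψ ^ (i + 1) turns τ′ i into (τ i)⁻¹.
    mirror-conjugate : ∀ {τ′} i γ → (Ψ ^ zero) · γ ≃ Ψ ^ suc i → IsRotations (Ψ ^ zero) τ′ →
                       τ′ i Γ.∙ γ Γ.≈ γ Γ.∙ τ i Γ.⁻¹
    mirror-conjugate {τ′} i γ e rot′ = rigid {Ψ ^ zero} (τ′ i Γ.∙ γ) (γ Γ.∙ τ i Γ.⁻¹) (begin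
      (Ψ ^ zero) · (τ′ i Γ.∙ γ)           ≈⟨ ⟨ (λ _ → Eq.refl) ⟩ ⟩
      (Ψ ^ zero · τ′ i) · γ               ≈⟨ ·-cong γ (rot′ i) ⟩
      (Ψ ^ zero ^ suc i ^ inject₁ i) · γ  ≈⟨ ^^-· γ _ _ e ⟩
      Ψ ^ suc i ^ suc i ^ inject₁ i       ≈⟨ ^-cong _ (^-involutive _ _) ⟩
      Ψ ^ inject₁ i                       ≈⟨ ^-involutive _ _ ⟨
      Ψ ^ inject₁ i ^ suc i ^ suc i       ≈⟨ ^-cong _ (inverse-rotation i) ⟨
      (Ψ · (τ i Γ.⁻¹)) ^ suc i            ≈⟨ ·-^ _ _ (τ i Γ.⁻¹) ⟨
      (Ψ ^ suc i) · (τ i Γ.⁻¹)            ≈⟨ ·-cong (τ i Γ.⁻¹) e ⟨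
      (Ψ ^ zero · γ) · (τ i Γ.⁻¹)         ≈⟨ ⟨ (λ _ → Eq.refl) ⟩ ⟩
      (Ψ ^ zero) · (γ Γ.∙ τ i Γ.⁻¹)       ∎)

    private
      ⟦_⟧τ : Word (Fin m) → Automorphism
      ⟦_⟧τ = eval Γ τ

    -- The product telescopes: each exchange at an inner rank occurs twice in a row and cancels. The
    -- ranks are supplied by `r` so that the recursion can shift both families.
    prefix-rotation : ∀ {k} (s : Fin k → Word (Fin m)) (r : Fin (suc k) → Fin (suc m)) →
      (∀ i → Ψ · ⟦ s i ⟧τ ≃ Ψ ^ r (suc i) ^ r (inject₁ i)) →
      ∀ j → Ψ · ⟦ prefix s j ⟧τ ≃ Ψ ^ r (suc j) ^ r zero
    prefix-rotation s r h zero    = h zero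
    prefix-rotation s r h (suc j) = begin
      Ψ · ⟦ s zero ∙ prefix (s ∘ suc) j ⟧τ
        ≈⟨ ⟨ (λ _ → Eq.refl) ⟩ ⟩
      (Ψ · ⟦ s zero ⟧τ) · ⟦ prefix (s ∘ suc) j ⟧τ
        ≈⟨ ·-cong ⟦ prefix (s ∘ suc) j ⟧τ (h zero) ⟩
      (Ψ ^ r (suc zero) ^ r zero) · ⟦ prefix (s ∘ suc) j ⟧τ
        ≈⟨ ^^-· ⟦ prefix (s ∘ suc) j ⟧τ _ _ (prefix-rotation (s ∘ suc) (r ∘ suc) (h ∘ suc) j) ⟩
      Ψ ^ r (suc (suc j)) ^ r (suc zero) ^ r (suc zero) ^ r zero
        ≈⟨ ^-cong _ (^-involutive _ _) ⟩
      Ψ ^ r (suc (suc j)) ^ r zero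
        ∎

    segment-rotation : ∀ {k} (s : Fin k → Word (Fin m)) (r : Fin (suc k) → Fin (suc m)) →
      (∀ i → Ψ · ⟦ s i ⟧τ ≃ Ψ ^ r (suc i) ^ r (inject₁ i)) →
      ∀ {i j} → i Fin.≤ j → Ψ · ⟦ segment s i j ⟧τ ≃ Ψ ^ r (suc j) ^ r (inject₁ i)
    segment-rotation s r h {zero}  {j}     _         = prefix-rotation s r h j
    segment-rotation s r h {suc i} {suc j} (s≤s i≤j) =
      segment-rotation (s ∘ suc) (r ∘ suc) (h ∘ suc) i≤j

    -- A segment acts on Ψ as exchanges at ranks j + 1 and i. As i < j, these ranks are at least two
    -- apart, so the exchanges commute and each cancels against its second occurrence.
    segment-squared : ∀ {i j} → i Fin.< j → ⟦ power 2 (segment gen i j) ⟧τ Γ.≈ Γ.ε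
    segment-squared {i} {j} i<j = rigid {Ψ} ⟦ power 2 (segment gen i j) ⟧τ Γ.ε (begin
      Ψ · ⟦ power 2 (segment gen i j) ⟧τ           ≈⟨ ⟨ (λ _ → Eq.refl) ⟩ ⟩
      (Ψ · x) · x                                  ≈⟨ ·-cong x turn ⟩
      (Ψ ^ suc j ^ inject₁ i) · x                  ≈⟨ ^^-· x _ _ turn ⟩
      Ψ ^ suc j ^ inject₁ i ^ suc j ^ inject₁ i    ≈⟨ ^-cong _ (^-comm _ i+1<j+1) ⟩
      Ψ ^ suc j ^ suc j ^ inject₁ i ^ inject₁ i    ≈⟨ ^-involutive _ _ ⟩
      Ψ ^ suc j ^ suc j                            ≈⟨ ^-involutive _ _ ⟩
      Ψ                                            ≈⟨ ⟨ (λ _ → Eq.refl) ⟩ ⟩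
      Ψ · Γ.ε                                      ∎)
      where
      x = ⟦ segment gen i j ⟧τ
      turn : Ψ · x ≃ Ψ ^ suc j ^ inject₁ i
      turn = segment-rotation gen id rot (ℕₚ.<⇒≤ i<j)
      i+1<j+1 : suc (toℕ (inject₁ i)) ℕ.< toℕ (suc j)
      i+1<j+1 = s≤s (≡.subst (ℕ._< toℕ j) (≡.sym (Finₚ.toℕ-inject₁ i)) i<j)

  -- The geometric source of the formula for w̄: its substituted words are the rotations at Ψ ^
  -- zero. From the third generator on, the exchange at rank 0 simply commutes past.
  mirror-rotations : ∀ {Ψ τ} → IsRotations Ψ τ → IsRotations (Ψ ^ zero) (eval Γ τ ∘ mirrorGenerator)
  mirror-rotations {Ψ} {τ} rot zero = begin
    (Ψ ^ zero) · (τ zero Γ.⁻¹)   ≈⟨ ·-^ Ψ zero (τ zero Γ.⁻¹) ⟩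
    (Ψ · (τ zero Γ.⁻¹)) ^ zero   ≈⟨ ^-cong _ (inverse-rotation rot zero) ⟩
    Ψ ^ zero ^ suc zero ^ zero   ∎
  mirror-rotations {Ψ} {τ} rot (suc zero) = begin
    (Ψ ^ zero) · (τ zero Γ.∙ τ zero Γ.∙ τ (suc zero))
      ≈⟨ ·-^ Ψ zero (τ zero Γ.∙ τ zero Γ.∙ τ (suc zero)) ⟩
    (Ψ · (τ zero Γ.∙ τ zero Γ.∙ τ (suc zero))) ^ zero
      ≈⟨ ^-cong _ two-turns ⟩
    Ψ ^ 2+ ^ zero ^ suc zero ^ zero ^ zero
      ≈⟨ ^-involutive _ _ ⟩
    Ψ ^ 2+ ^ zero ^ suc zero
      ≈⟨ ^-cong _ (^-comm Ψ (s≤s (s≤s ℕ.z≤n))) ⟨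
    Ψ ^ zero ^ 2+ ^ suc zero
      ∎
    where
    2+ = suc (suc zero)

    one-turn : (Ψ · τ zero) · τ (suc zero) ≃ Ψ ^ 2+ ^ zero
    one-turn = begin
      (Ψ · τ zero) · τ (suc zero)                ≈⟨ ·-cong (τ (suc zero)) (rot zero) ⟩
      (Ψ ^ suc zero ^ zero) · τ (suc zero)       ≈⟨ ^^-· (τ (suc zero)) _ _ (rot (suc zero)) ⟩
      Ψ ^ 2+ ^ suc zero ^ suc zero ^ zero        ≈⟨ ^-cong _ (^-involutive _ _) ⟩
      Ψ ^ 2+ ^ zero                              ∎

    -- The first `τ zero` acts on Ψ; the product of the other two factors then passes inside both
    -- exchanges, where `one-turn` evaluates it.
    two-turns : Ψ · (τ zero Γ.∙ τ zero Γ.∙ τ (suc zero)) ≃ Ψ ^ 2+ ^ zero ^ suc zero ^ zero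
    two-turns = begin
      Ψ · (τ zero Γ.∙ τ zero Γ.∙ τ (suc zero))
        ≈⟨ ⟨ (λ _ → Eq.refl) ⟩ ⟩
      ((Ψ · τ zero) · τ zero) · τ (suc zero)
        ≈⟨ ·-cong (τ (suc zero)) (·-cong (τ zero) (rot zero)) ⟩
      ((Ψ ^ suc zero ^ zero) · τ zero) · τ (suc zero)
        ≈⟨ ⟨ (λ _ → Eq.refl) ⟩ ⟩
      (Ψ ^ suc zero ^ zero) · (τ zero Γ.∙ τ (suc zero))
        ≈⟨ ^^-· (τ zero Γ.∙ τ (suc zero)) _ _ (≃.trans ⟨ (λ _ → Eq.refl) ⟩ one-turn) ⟩
      Ψ ^ 2+ ^ zero ^ suc zero ^ zero
        ∎
  mirror-rotations {Ψ} {τ} rot (suc (suc j)) = begin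
    (Ψ ^ zero) · τ i                ≈⟨ ·-^ Ψ zero (τ i) ⟩
    (Ψ · τ i) ^ zero                ≈⟨ ^-cong _ (rot i) ⟩
    Ψ ^ suc i ^ inject₁ i ^ zero    ≈⟨ ^-comm _ (s≤s (s≤s ℕ.z≤n)) ⟨
    Ψ ^ suc i ^ zero ^ inject₁ i    ≈⟨ ^-cong _ (^-comm _ (s≤s (s≤s ℕ.z≤n))) ⟨
    Ψ ^ zero ^ suc i ^ inject₁ i    ∎
    where i = suc (suc j)

-- Exchanges and rotations under duality.

opposite-inject₁ : ∀ {n} (i : Fin n) → opposite (inject₁ i) ≡ suc (opposite i)
opposite-inject₁ zero    = ≡.refl
opposite-inject₁ (suc i) = ≡.cong inject₁ (opposite-inject₁ i)

module Duality {m c ℓ₁ ℓ₂} (P : Polytope (suc m) c ℓ₁ ℓ₂) where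
  private
    module P  = Polytope P
    module Pᵟ = Polytope (dual P)
    module F  = Flags P
    module Fᵟ = Flags (dual P)
    module R  = Rotations P
    module Rᵟ = Rotations (dual P)
    module Γ  = Group P.Γ

  dualFlag-reflects-≃ : ∀ {Φ Ψ} → dualFlag P Φ Fᵟ.≃ dualFlag P Ψ → Φ F.≃ Ψ
  dualFlag-reflects-≃ {Φ} {Ψ} e = F.⟨ (λ i →
    ≡.subst (λ x → P.face Φ x P.≈ P.face Ψ x) (Finₚ.opposite-involutive i) (Fᵟ.faces e (opposite i))) ⟩

  dualFlag-^ : ∀ Φ j → dualFlag P (Φ P.^ j) Fᵟ.≃ dualFlag P Φ Pᵟ.^ opposite j
  dualFlag-^ Φ j = Fᵟ.^-unique {opposite j} Fᵟ.≃.refl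
    -- Reversal takes the index `at j` to `inject₁ (opposite (inject₁ j))`, which is
    -- `at (opposite j)`.
    (≡.subst (λ x → Pᵟ.DifferExactlyAt x (dualFlag P Φ) (dualFlag P (Φ P.^ j)))
      (≡.cong inject₁ (opposite-inject₁ j))
      (proj₂ (adjacent-dual P {Φ} {Φ P.^ j} (_ , P.^-differs Φ j))))

  dualFlag-^^ : ∀ Φ i j → dualFlag P (Φ P.^ i P.^ j) Fᵟ.≃ dualFlag P Φ Pᵟ.^ opposite i Pᵟ.^ opposite j
  dualFlag-^^ Φ i j = Fᵟ.≃.trans (dualFlag-^ (Φ P.^ i) j) (Fᵟ.^-cong (opposite j) (dualFlag-^ Φ i))

  -- Reversing ranks makes the two exchanges of a rotation occur in the other order, which is an
  -- inverse rotation; hence the inverses in δ.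
  undual-rotations : ∀ {Ψ τ} → Rᵟ.IsRotations (dualFlag P Ψ) τ →
                     R.IsRotations Ψ (λ i → undualAutomorphism P (τ (opposite i)) Γ.⁻¹)
  undual-rotations {Ψ} {τ} rot i = F.·-⁻¹ τᵢ (begin
      (Ψ P.^ suc i P.^ inject₁ i) P.· τᵢ
        ≈⟨ F.^^-· τᵢ _ _ turn ⟩
      Ψ P.^ inject₁ i P.^ suc i P.^ suc i P.^ inject₁ i
        ≈⟨ F.^-cong _ (F.^-involutive _ _) ⟩
      Ψ P.^ inject₁ i P.^ inject₁ i
        ≈⟨ F.^-involutive _ _ ⟩
      Ψ ∎)
    where
    open SetoidReasoning F.≃-setoid
    τᵢ = undualAutomorphism P (τ (opposite i))

    turn : Ψ P.· τᵢ F.≃ Ψ P.^ inject₁ i P.^ suc i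
    turn = dualFlag-reflects-≃ (Fᵟ.≃.trans Fᵟ.⟨ Fᵟ.faces (rot (opposite i)) ⟩ (Fᵟ.≃.trans
      (Fᵟ.≃.reflexive (≡.cong (λ x → dualFlag P Ψ Pᵟ.^ x Pᵟ.^ inject₁ (opposite i)) (≡.sym (opposite-inject₁ i))))
      (Fᵟ.≃.sym (dualFlag-^^ Ψ (inject₁ i) (suc i)))))

-- Evaluation of words in a group, conjugation and powers.

module Evaluation {a ℓ} (G : Group a ℓ) where
  open Group G using (Carrier; setoid; monoid)
    renaming (_≈_ to _≈′_; _∙_ to _∙′_; ε to ε′; _⁻¹ to _⁻¹′)
  private module G = Group G
  open GroupProperties G using (⁻¹-anti-homo-∙; ⁻¹-injective; ε⁻¹≈ε; \\-leftDividesʳ; ∙-cancelˡ; ∙-cancelʳ)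
  open Mult monoid using (×-homo-+; ×-homo-1) renaming (_×_ to _^′_)
  open SetoidReasoning setoid

  eval-extend : ∀ {X Y : Set} (ρ : Y → Carrier) (f : X → Word Y) w →
                eval G ρ (extend f w) ≡ eval G (eval G ρ ∘ f) w
  eval-extend ρ f (gen x) = ≡.refl
  eval-extend ρ f ε       = ≡.refl
  eval-extend ρ f (v ∙ w) = ≡.cong₂ _∙′_ (eval-extend ρ f v) (eval-extend ρ f w)
  eval-extend ρ f (w ⁻¹)  = ≡.cong _⁻¹′ (eval-extend ρ f w)

  eval-power : ∀ {X : Set} (ρ : X → Carrier) q w → eval G ρ (power q w) ≡ q ^′ eval G ρ w
  eval-power ρ zero    w = ≡.refl
  eval-power ρ (suc q) w = ≡.cong (eval G ρ w ∙′_) (eval-power ρ q w)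

  eval-cong : ∀ {X : Set} {ρ ρ′ : X → Carrier} → (∀ x → ρ x ≈′ ρ′ x) → ∀ w → eval G ρ w ≈′ eval G ρ′ w
  eval-cong e (gen x) = e x
  eval-cong e ε       = G.refl
  eval-cong e (v ∙ w) = G.∙-cong (eval-cong e v) (eval-cong e w)
  eval-cong e (w ⁻¹)  = G.⁻¹-cong (eval-cong e w)

  -- Conjugacy by g, with the inverse of g cleared.
  Intertwines : Carrier → Carrier → Carrier → Set ℓ
  Intertwines g x y = x ∙′ g ≈′ g ∙′ y

  module _ {g : Carrier} where
    intertwines-ε : Intertwines g ε′ ε′
    intertwines-ε = G.trans (G.identityˡ g) (G.sym (G.identityʳ g))

    intertwines-∙ : ∀ {x x′ y y′} → Intertwines g x y → Intertwines g x′ y′ → Intertwines g (x ∙′ x′) (y ∙′ y′)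
    intertwines-∙ {x} {x′} {y} {y′} e e′ = begin
      (x ∙′ x′) ∙′ g   ≈⟨ G.assoc x x′ g ⟩
      x ∙′ (x′ ∙′ g)   ≈⟨ G.∙-congˡ e′ ⟩
      x ∙′ (g ∙′ y′)   ≈⟨ G.assoc x g y′ ⟨
      (x ∙′ g) ∙′ y′   ≈⟨ G.∙-congʳ e ⟩
      (g ∙′ y) ∙′ y′   ≈⟨ G.assoc g y y′ ⟩
      g ∙′ (y ∙′ y′)   ∎

    intertwines-⁻¹ : ∀ {x y} → Intertwines g x y → Intertwines g (x ⁻¹′) (y ⁻¹′)
    intertwines-⁻¹ {x} {y} e = begin
      x ⁻¹′ ∙′ g                      ≈⟨ G.∙-congˡ (G.identityʳ g) ⟨
      x ⁻¹′ ∙′ (g ∙′ ε′)              ≈⟨ G.∙-congˡ (G.∙-congˡ (G.inverseʳ y)) ⟨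
      x ⁻¹′ ∙′ (g ∙′ (y ∙′ y ⁻¹′))    ≈⟨ G.∙-congˡ (G.assoc g y (y ⁻¹′)) ⟨
      x ⁻¹′ ∙′ ((g ∙′ y) ∙′ y ⁻¹′)    ≈⟨ G.∙-congˡ (G.∙-congʳ e) ⟨
      x ⁻¹′ ∙′ ((x ∙′ g) ∙′ y ⁻¹′)    ≈⟨ G.∙-congˡ (G.assoc x g (y ⁻¹′)) ⟩
      x ⁻¹′ ∙′ (x ∙′ (g ∙′ y ⁻¹′))    ≈⟨ \\-leftDividesʳ x (g ∙′ y ⁻¹′) ⟩
      g ∙′ y ⁻¹′                      ∎

    intertwines-eval : ∀ {X : Set} {ρ ρ′ : X → Carrier} → (∀ x → Intertwines g (ρ x) (ρ′ x)) →
                       ∀ w → Intertwines g (eval G ρ w) (eval G ρ′ w)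
    intertwines-eval e (gen x) = e x
    intertwines-eval e ε       = intertwines-ε
    intertwines-eval e (v ∙ w) = intertwines-∙ (intertwines-eval e v) (intertwines-eval e w)
    intertwines-eval e (w ⁻¹)  = intertwines-⁻¹ (intertwines-eval e w)

    intertwines-power : ∀ {x y} → Intertwines g x y → ∀ q → Intertwines g (q ^′ x) (q ^′ y)
    intertwines-power e zero    = intertwines-ε
    intertwines-power e (suc q) = intertwines-∙ e (intertwines-power e q)

    intertwines⇒⇔ : ∀ {x x′ y y′} → Intertwines g x y → Intertwines g x′ y′ → x ≈′ x′ ⇔ y ≈′ y′
    intertwines⇒⇔ e e′ = mk⇔
      (λ x≈x′ → ∙-cancelˡ g _ _ (G.trans (G.sym e) (G.trans (G.∙-congʳ x≈x′) e′)))
      (λ y≈y′ → ∙-cancelʳ g _ _ (G.trans e (G.trans (G.∙-congˡ y≈y′) (G.sym e′))))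

  power-⁻¹ : ∀ x q → q ^′ (x ⁻¹′) ≈′ (q ^′ x) ⁻¹′
  power-⁻¹ x zero    = G.sym ε⁻¹≈ε
  power-⁻¹ x (suc q) = begin
    x ⁻¹′ ∙′ q ^′ (x ⁻¹′)   ≈⟨ G.∙-congˡ (power-⁻¹ x q) ⟩
    x ⁻¹′ ∙′ (q ^′ x) ⁻¹′   ≈⟨ ⁻¹-anti-homo-∙ (q ^′ x) x ⟨
    (q ^′ x ∙′ x) ⁻¹′       ≈⟨ G.⁻¹-cong (G.∙-congˡ (×-homo-1 x)) ⟨
    (q ^′ x ∙′ 1 ^′ x) ⁻¹′  ≈⟨ G.⁻¹-cong (×-homo-+ x q 1) ⟨
    ((q ℕ.+ 1) ^′ x) ⁻¹′    ≡⟨ ≡.cong (λ r → (r ^′ x) ⁻¹′) (ℕₚ.+-comm q 1) ⟩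
    (x ∙′ q ^′ x) ⁻¹′       ∎

  power-⁻¹-trivial : ∀ x q → q ^′ (x ⁻¹′) ≈′ ε′ ⇔ q ^′ x ≈′ ε′
  power-⁻¹-trivial x q = mk⇔
    (λ e → ⁻¹-injective (G.trans (G.sym (power-⁻¹ x q)) (G.trans e (G.sym ε⁻¹≈ε))))
    (λ e → G.trans (power-⁻¹ x q) (G.trans (G.⁻¹-cong e) ε⁻¹≈ε))

  -- `ρ′ x` is conjugate to the inverse of `ρ x`, so their powers are trivial together.
  intertwines-⁻¹-power : ∀ {X : Set} g (ρ ρ′ : X → Carrier) x q → Intertwines g (ρ′ x) (ρ x ⁻¹′) →
                         eval G ρ (power q (gen x)) ≈′ ε′ → eval G ρ′ (power q (gen x)) ≈′ ε′
  intertwines-⁻¹-power g ρ ρ′ x q i e = begin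
    eval G ρ′ (power q (gen x)) ≡⟨ eval-power ρ′ q (gen x) ⟩
    q ^′ ρ′ x                   ≈⟨ Equivalence.from (intertwines⇒⇔ (intertwines-power i q) intertwines-ε)
                                     (Equivalence.from (power-⁻¹-trivial (ρ x) q)
                                       (G.trans (G.reflexive (≡.sym (eval-power ρ q (gen x)))) e)) ⟩
    ε′                          ∎

  eval-⁻¹-power : ∀ {X Y : Set} (ρ : Y → Carrier) (f : X → Y) x q →
                  eval G ρ (extend (λ x → gen (f x) ⁻¹) (power q (gen x))) ≈′ ε′ →
                  eval G ρ (power q (gen (f x))) ≈′ ε′
  eval-⁻¹-power ρ f x q e = begin
    eval G ρ (power q (gen (f x))) ≡⟨ eval-power ρ q (gen (f x)) ⟩
    q ^′ ρ (f x)                   ≈⟨ Equivalence.to (power-⁻¹-trivial (ρ (f x)) q) (begin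
      q ^′ (ρ (f x) ⁻¹′)
        ≡⟨ eval-power _ q (gen x) ⟨
      eval G (λ x → ρ (f x) ⁻¹′) (power q (gen x))
        ≡⟨ eval-extend ρ (λ x → gen (f x) ⁻¹) (power q (gen x)) ⟨
      eval G ρ (extend (λ x → gen (f x) ⁻¹) (power q (gen x)))
        ≈⟨ e ⟩
      ε′
        ∎) ⟩
    ε′                             ∎

module _ {a b ℓ ℓ′} (G : Group a ℓ) (H : Group b ℓ′) where
  private
    module G = Group G
    module H = Group H

  eval-hom : (h : G.Carrier → H.Carrier) → h G.ε H.≈ H.ε →
             (∀ x y → h (x G.∙ y) H.≈ h x H.∙ h y) → (∀ x → h (x G.⁻¹) H.≈ h x H.⁻¹) →
             ∀ {X : Set} (ρ : X → G.Carrier) w → h (eval G ρ w) H.≈ eval H (h ∘ ρ) w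
  eval-hom h h-ε h-∙ h-⁻¹ ρ = go
    where
    go : ∀ w → h (eval G ρ w) H.≈ eval H (h ∘ ρ) w
    go (gen x) = H.refl
    go ε       = h-ε
    go (v ∙ w) = H.trans (h-∙ _ _) (H.∙-cong (go v) (go w))
    go (w ⁻¹)  = H.trans (h-⁻¹ _) (H.⁻¹-cong (go w))

-- Congruence of words, in mixes and in the comix.

infix 4 _⊨_≈_

_⊨_≈_ : ∀ {k a ℓ} → Marked k a ℓ → Word (Fin k) → Word (Fin k) → Set ℓ
G ⊨ u ≈ v = ⟦ u ⟧ ≈ ⟦ v ⟧
  where open Marked G using (⟦_⟧; _≈_)

module _ {k a b ℓ ℓ′} (G : Marked k a ℓ) (H : Marked k b ℓ′) where
  private
    module G = Marked G
    module H = Marked H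
    module G⋄H = Marked (G ⋄ H)
    G×H : Group _ _
    G×H = Product.group G.group H.group
    module G×H = Group G×H

  ⋄-evalˡ : ∀ w → proj₁ (proj₁ G⋄H.⟦ w ⟧) G.≈ G.⟦ w ⟧
  ⋄-evalˡ = eval-hom G⋄H.group G.group (proj₁ ∘ proj₁) G.refl (λ _ _ → G.refl) (λ _ → G.refl) _

  ⋄-evalʳ : ∀ w → proj₂ (proj₁ G⋄H.⟦ w ⟧) H.≈ H.⟦ w ⟧
  ⋄-evalʳ = eval-hom G⋄H.group H.group (proj₂ ∘ proj₁) H.refl (λ _ _ → H.refl) (λ _ → H.refl) _

  -- The kernel of a mix is the intersection of the two kernels.
  ⋄-⊨ : ∀ u v → G ⋄ H ⊨ u ≈ v ⇔ (G ⊨ u ≈ v × H ⊨ u ≈ v)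
  ⋄-⊨ u v = mk⇔
    (λ (e , e′) → G.trans (G.sym (⋄-evalˡ u)) (G.trans e (⋄-evalˡ v)) ,
                  H.trans (H.sym (⋄-evalʳ u)) (H.trans e′ (⋄-evalʳ v)))
    (λ (e , e′) → G.trans (⋄-evalˡ u) (G.trans e (G.sym (⋄-evalˡ v))) ,
                  H.trans (⋄-evalʳ u) (H.trans e′ (H.sym (⋄-evalʳ v))))

  ⋄-word : G⋄H.Carrier → Word (Fin k)
  ⋄-word (_ , w , _) = w

  ⋄-word-eval : ∀ x → G⋄H.⟦ ⋄-word x ⟧ G⋄H.≈ x
  ⋄-word-eval (x , w , e) = G×H.trans
    (eval-hom G⋄H.group G×H proj₁ G×H.refl (λ _ _ → G×H.refl) (λ _ → G×H.refl) G⋄H.generator w) e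

-- Merging the two alphabets makes the identifying relators x⁻¹x′ of the comix trivial in every
-- group.
codiagonal : ∀ {X : Set} → Word (X ⊎ X) → Word X
codiagonal = mapWord [ id , id ]

codiagonal-mapWord : ∀ {X : Set} (i : X → X ⊎ X) → (∀ x → [ id , id ] (i x) ≡ x) →
                     ∀ w → codiagonal (mapWord i w) ≡ w
codiagonal-mapWord i e (gen x) = ≡.cong gen (e x)
codiagonal-mapWord i e ε       = ≡.refl
codiagonal-mapWord i e (v ∙ w) = ≡.cong₂ _∙_ (codiagonal-mapWord i e v) (codiagonal-mapWord i e w)
codiagonal-mapWord i e (w ⁻¹)  = ≡.cong _⁻¹ (codiagonal-mapWord i e w)

module _ {a b ℓ ℓ′} {X : Set} {R S : Presentation X} (A : Group a ℓ) (B : Group b ℓ′)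
         (α : X → Group.Carrier A) (β : X → Group.Carrier B)
         (α-R : ∀ {w} → R w → Group._≈_ A (eval A α w) (Group.ε A))
         (β-S : ∀ {w} → S w → Group._≈_ B (eval B β w) (Group.ε B)) where
  private
    module A = Group A
    module B = Group B

  private
    ⟦_⟧α : Word X → A.Carrier
    ⟦_⟧α = eval A α

    ⟦_⟧β : Word X → B.Carrier
    ⟦_⟧β = eval B β

  -- Composing the kernels of α and β gives a congruence, since congruences of
  -- groups commute; in `sym` and `trans` this is the Mal'cev term x y⁻¹ z.
  comix-sound : ∀ {u v} → Comix R S ⊢ u ≈ v →
                ∃ λ w → ⟦ w ⟧α A.≈ ⟦ codiagonal u ⟧α × ⟦ w ⟧β B.≈ ⟦ codiagonal v ⟧β
  -- The witness has to match the left side under α and the right side under β. The empty word does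
  -- so for a relator of R, which α kills; a relator of S, killed by β, is its own witness.
  comix-sound (relator (left {w} r)) = ε ,
    A.sym (A.trans (A.reflexive (≡.cong ⟦_⟧α (codiagonal-mapWord inj₁ (λ _ → ≡.refl) w))) (α-R r)) , B.refl
  comix-sound (relator (right {w} s)) = codiagonal (mapWord inj₂ w) ,
    A.refl , B.trans (B.reflexive (≡.cong ⟦_⟧β (codiagonal-mapWord inj₂ (λ _ → ≡.refl) w))) (β-S s)
  comix-sound (relator (identify x)) = ε , A.sym (A.inverseˡ (α x)) , B.refl
  comix-sound (refl {w}) = codiagonal w , A.refl , B.refl
  comix-sound (sym {v} {w} e) with comix-sound e
  ... | x , p , q = codiagonal w ∙ x ⁻¹ ∙ codiagonal v ,
    A.trans (A.∙-congˡ (A.sym p)) (GroupProperties.//-rightDividesˡ A ⟦ x ⟧α ⟦ codiagonal w ⟧α) ,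
    B.trans (B.∙-congʳ (B.trans (B.∙-congˡ (B.⁻¹-cong q)) (B.inverseʳ ⟦ codiagonal w ⟧β))) (B.identityˡ _)
  comix-sound (trans {v = v} e e′) with comix-sound e | comix-sound e′
  ... | x , p , q | x′ , p′ , q′ = x ∙ codiagonal v ⁻¹ ∙ x′ ,
    A.trans (A.∙-congˡ p′) (A.trans (GroupProperties.//-rightDividesˡ A ⟦ codiagonal v ⟧α ⟦ x ⟧α) p) ,
    B.trans (B.∙-congʳ (B.trans (B.∙-congʳ q) (B.inverseʳ ⟦ codiagonal v ⟧β))) (B.trans (B.identityˡ _) q′)
  comix-sound (∙-cong e e′) with comix-sound e | comix-sound e′
  ... | x , p , q | x′ , p′ , q′ = x ∙ x′ , A.∙-cong p p′ , B.∙-cong q q′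
  comix-sound (⁻¹-cong e) with comix-sound e
  ... | x , p , q = x ⁻¹ , A.⁻¹-cong p , B.⁻¹-cong q
  comix-sound (assoc u v w)  = codiagonal (u ∙ v ∙ w) , A.refl , B.assoc _ _ _
  comix-sound (identityˡ w)  = codiagonal (ε ∙ w) , A.refl , B.identityˡ _
  comix-sound (identityʳ w)  = codiagonal (w ∙ ε) , A.refl , B.identityʳ _
  comix-sound (inverseˡ w)   = codiagonal (w ⁻¹ ∙ w) , A.refl , B.inverseˡ _
  comix-sound (inverseʳ w)   = codiagonal (w ∙ w ⁻¹) , A.refl , B.inverseʳ _

-- The rotation groups of a chiral polytope and of its mirror image.

module _ {m c ℓ₁ ℓ₂} (𝒬 : ChiralPolytope (suc m) c ℓ₁ ℓ₂) where
  open ChiralPolytope 𝒬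
  open Polytope polytope using (Γ; _^_; ^-differs; module Eq; at)
  open Flags polytope
  open Rotations polytope
  open Evaluation Γ
  private module Γ = Group Γ

  σ-rotations : IsRotations base (σ 𝒬)
  σ-rotations i = ⟨ σ-base 𝒬 i ⟩

  σ-rotations-mirror : IsRotations (base ^ zero) (σ (mirror 𝒬))
  σ-rotations-mirror i = ⟨ σ-base (mirror 𝒬) i ⟩

  σ-segment-squared : ∀ {i j} → i Fin.< j → Γ⁺ 𝒬 ⊨ power 2 (segment gen i j) ≈ ε
  σ-segment-squared = segment-squared σ-rotations

  -- The chosen generators of the mirror image and the words of `mirrorGenerator` are both rotations
  -- at `base ^ zero`, so rigidity identifies them.
  mirror-eval : ∀ w → Marked.⟦_⟧ (Γ⁺ (mirror 𝒬)) w Γ.≈ Marked.⟦_⟧ (Γ⁺ 𝒬) (mirrorWord w)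
  mirror-eval w = Γ.trans
    {i = eval Γ (σ (mirror 𝒬)) w}
    {j = eval Γ (eval Γ (σ 𝒬) ∘ mirrorGenerator) w}
    {k = eval Γ (σ 𝒬) (mirrorWord w)}
    (eval-cong {ρ = σ (mirror 𝒬)} {ρ′ = eval Γ (σ 𝒬) ∘ mirrorGenerator}
      (rotations-unique σ-rotations-mirror {eval Γ (σ 𝒬) ∘ mirrorGenerator} (mirror-rotations σ-rotations)) w)
    (Γ.reflexive (≡.sym (eval-extend (σ 𝒬) mirrorGenerator w)))

  mirror-⊨ : ∀ {u v} → Γ⁺ 𝒬 ⊨ mirrorWord u ≈ mirrorWord v → Γ⁺ (mirror 𝒬) ⊨ u ≈ v
  mirror-⊨ {u} {v} e F = Eq.trans (mirror-eval u F) (Eq.trans (e F) (Eq.sym (mirror-eval v F)))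

  ^-sameOrbit : ∀ Φ i j → Polytope.SameOrbit polytope (Φ ^ i) (Φ ^ j)
  ^-sameOrbit Φ i j = Polytope.IsChiral.even isChiral (Φ ^ i) Φ (Φ ^ j)
    (at i , proj₁ (^-differs Φ i) ∘ Eq.sym , λ k k≢ → Eq.sym (proj₂ (^-differs Φ i) k k≢))
    (at j , ^-differs Φ j)

  -- In a chiral polytope all flags adjacent to the base flag lie in one orbit, so some γ takes
  -- `base ^ zero` to `base ^ suc i`; it conjugates the generator of the mirror image to the inverse
  -- of the original one.
  mirror-power : ∀ i q → Γ⁺ 𝒬 ⊨ power q (gen i) ≈ ε → Γ⁺ (mirror 𝒬) ⊨ power q (gen i) ≈ ε
  mirror-power i q = intertwines-⁻¹-power γ (σ 𝒬) (σ (mirror 𝒬)) i q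
    (mirror-conjugate σ-rotations i γ ⟨ proj₂ orbit ⟩ σ-rotations-mirror)
    where
    orbit = ^-sameOrbit base zero (suc i)
    γ = proj₁ orbit

-- The rotation groups of duals; `reverseWord` is δ on words.

reverseWord : ∀ {m} → Word (Fin m) → Word (Fin m)
reverseWord = extend (λ i → gen (opposite i) ⁻¹)

module _ {m c ℓ₁ ℓ₂} (P : Polytope (suc m) c ℓ₁ ℓ₂) where
  private
    module P  = Polytope P
    module Pᵟ = Polytope (dual P)
    module Γ  = Group P.Γ
    module Γᵟ = Group Pᵟ.Γ
  open Duality P
  open Evaluation P.Γ

  dual-eval : ∀ (τ : Fin m → Pᵟ.Automorphism) w →
    undualAutomorphism P (eval Pᵟ.Γ τ (reverseWord w)) Γ.≈
    eval P.Γ (λ i → undualAutomorphism P (τ (opposite i)) Γ.⁻¹) w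
  dual-eval τ w = Γ.trans
    {i = undualAutomorphism P (eval Pᵟ.Γ τ (reverseWord w))}
    {j = eval P.Γ (undualAutomorphism P ∘ τ) (reverseWord w)}
    {k = eval P.Γ (λ i → undualAutomorphism P (τ (opposite i)) Γ.⁻¹) w}
    (eval-hom Pᵟ.Γ P.Γ (undualAutomorphism P)
      (λ _ → P.Eq.refl) (λ _ _ _ → P.Eq.refl) (λ _ _ → P.Eq.refl) τ (reverseWord w))
    (Γ.reflexive (eval-extend (undualAutomorphism P ∘ τ) (λ i → gen (opposite i) ⁻¹) w))

  -- The rotations of the dual yield rotations `ρ₀` at Ψ, while ρ belongs to Ψ′. Flags in one orbit
  -- have conjugate rotations, and conjugation preserves which words agree.
  dual-≈ : ∀ {Ψ Ψ′ τ ρ} → Rotations.IsRotations (dual P) (dualFlag P Ψ) τ → Rotations.IsRotations P Ψ′ ρ →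
           P.SameOrbit Ψ Ψ′ → ∀ u v →
           eval Pᵟ.Γ τ (reverseWord u) Γᵟ.≈ eval Pᵟ.Γ τ (reverseWord v) ⇔ eval P.Γ ρ u Γ.≈ eval P.Γ ρ v
  dual-≈ {Ψ} {Ψ′} {τ} {ρ} rotᵟ rot (γ , e) u v = mk⇔
    (λ h → Equivalence.to conjugate λ F →
      P.Eq.trans (P.Eq.sym (dual-eval τ u F)) (P.Eq.trans (h F) (dual-eval τ v F)))
    (λ h F → P.Eq.trans (dual-eval τ u F)
      (P.Eq.trans (Equivalence.from conjugate h F) (P.Eq.sym (dual-eval τ v F))))
    where
    ρ₀ : Fin m → P.Automorphism
    ρ₀ i = undualAutomorphism P (τ (opposite i)) Γ.⁻¹

    intertwines : ∀ w → Intertwines γ (eval P.Γ ρ₀ w) (eval P.Γ ρ w)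
    intertwines = intertwines-eval {γ} {ρ = ρ₀} {ρ}
      (Rotations.rotations-conjugate P {Ψ} {ρ₀} (undual-rotations {Ψ} {τ} rotᵟ) {Ψ′} {ρ} γ Flags.⟨ e ⟩ rot)

    conjugate : eval P.Γ ρ₀ u Γ.≈ eval P.Γ ρ₀ v ⇔ eval P.Γ ρ u Γ.≈ eval P.Γ ρ v
    conjugate = intertwines⇒⇔ {γ} {eval P.Γ ρ₀ u} {eval P.Γ ρ₀ v} {eval P.Γ ρ u} {eval P.Γ ρ v}
      (intertwines u) (intertwines v)

reverse-power : ∀ {m a ℓ} (G : Marked m a ℓ) i q →
                G ⊨ reverseWord (power q (gen i)) ≈ ε → G ⊨ power q (gen (opposite i)) ≈ ε
reverse-power G i q = Evaluation.eval-⁻¹-power (Marked.group G) (Marked.generator G) opposite i q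

chiral : ∀ {n c ℓ₁ ℓ₂} (Q : Polytope n c ℓ₁ ℓ₂) → Polytope.Flag Q → Polytope.IsChiral Q →
         ChiralPolytope n c ℓ₁ ℓ₂
chiral Q Ψ χ = record { polytope = Q ; base = Ψ ; isChiral = χ }

-- By rigidity the relation R does not depend on the family τ, only on Ψ.
RotationEquality : ∀ {m c ℓ₁ ℓ₂} (Q : Polytope (suc m) c ℓ₁ ℓ₂) → Polytope.Flag Q →
                   (Word (Fin m) → Word (Fin m) → Set (c ⊔ ℓ₁)) → Set (c ⊔ ℓ₁ ⊔ ℓ₂)
RotationEquality Q Ψ R = ∃ λ τ → Rotations.IsRotations Q Ψ τ ×
  (∀ u v → Group._≈_ Γ (eval Γ τ u) (eval Γ τ v) ⇔ R u v)
  where open Polytope Q using (Γ)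

module _ {m c ℓ₁ ℓ₂} (Q : Polytope (suc m) c ℓ₁ ℓ₂) (Ψ : Polytope.Flag Q) (χ : Polytope.IsChiral Q) where
  Γ⁺-equality : RotationEquality Q Ψ (Γ⁺ (chiral Q Ψ χ) ⊨_≈_)
  Γ⁺-equality = σ (chiral Q Ψ χ) , σ-rotations (chiral Q Ψ χ) , λ _ _ → ⇔.refl

  Γ⁺-mirror-equality : RotationEquality Q (Polytope._^_ Q Ψ zero) (Γ⁺ (mirror (chiral Q Ψ χ)) ⊨_≈_)
  Γ⁺-mirror-equality = σ (mirror (chiral Q Ψ χ)) , σ-rotations-mirror (chiral Q Ψ χ) , λ _ _ → ⇔.refl

RotationEquality-resp-≃ : ∀ {m c ℓ₁ ℓ₂} (Q : Polytope (suc m) c ℓ₁ ℓ₂) {Ψ Ψ′ R} → Flags._≃_ Q Ψ Ψ′ →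
                          RotationEquality Q Ψ R → RotationEquality Q Ψ′ R
RotationEquality-resp-≃ Q {Ψ} {Ψ′} e (τ , rot , equality) =
  τ , Rotations.IsRotations-resp-≃ Q {Ψ} {τ} rot {Ψ′} e , equality

module _ {m c ℓ₁ ℓ₂} (P : Polytope (suc m) c ℓ₁ ℓ₂) where
  private
    module P  = Polytope P
    module Pᵟ = Polytope (dual P)
    module Fᵟ = Flags (dual P)

  dual-equality : ∀ {Ψ Ψ′ R S} → RotationEquality (dual P) (dualFlag P Ψ) R → RotationEquality P Ψ′ S →
                  P.SameOrbit Ψ Ψ′ → ∀ u v → R (reverseWord u) (reverseWord v) ⇔ S u v
  dual-equality {Ψ} {Ψ′} (τ , rotᵟ , equalityᵟ) (ρ , rot , equality) orbit u v =
    ⇔.trans (⇔.sym (equalityᵟ (reverseWord u) (reverseWord v)))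
      (⇔.trans (dual-≈ P {Ψ} {Ψ′} {τ} {ρ} rotᵟ rot orbit u v) (equality u v))

  dualFlag-^-zero : ∀ Ψ →
    Polytope._^_ (dual P) (dualFlag P Ψ) zero Fᵟ.≃ dualFlag P (Polytope._^_ P Ψ (opposite zero))
  dualFlag-^-zero Ψ = Fᵟ.≃.trans
    (Fᵟ.≃.reflexive (≡.cong (Polytope._^_ (dual P) (dualFlag P Ψ)) (≡.sym (Finₚ.opposite-involutive zero))))
    (Fᵟ.≃.sym (Duality.dualFlag-^ P Ψ (opposite zero)))

  -- 𝒬ᵟ is a variable because comparing terms that mention flags of an unfolded
  -- dual is infeasible for the conversion checker.
  module _ (Ψ : P.Flag) (χ : P.IsChiral) (χᵟ : Pᵟ.IsChiral) {𝒬 𝒬ᵟ : ChiralPolytope (suc m) c ℓ₁ ℓ₂} where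
    chiral-dual-⊨ : 𝒬 ≡ chiral P Ψ χ → 𝒬ᵟ ≡ chiral (dual P) (dualFlag P Ψ) χᵟ →
      ∀ u v → Γ⁺ 𝒬ᵟ ⊨ reverseWord u ≈ reverseWord v ⇔ Γ⁺ 𝒬 ⊨ u ≈ v
    chiral-dual-⊨ ≡.refl ≡.refl = dual-equality
      {Ψ} {Ψ} {Γ⁺ (chiral (dual P) (dualFlag P Ψ) χᵟ) ⊨_≈_} {Γ⁺ (chiral P Ψ χ) ⊨_≈_}
      (Γ⁺-equality (dual P) (dualFlag P Ψ) χᵟ) (Γ⁺-equality P Ψ χ)
      (Group.ε P.Γ , λ _ → P.Eq.refl)

    -- Rank 0 of the dual is rank `opposite zero` of P, so the two mirror images start from
    -- different flags of P. Both flags are adjacent to Ψ, hence in one orbit.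
    chiral-mirror-dual-⊨ : 𝒬 ≡ chiral P Ψ χ → 𝒬ᵟ ≡ chiral (dual P) (dualFlag P Ψ) χᵟ →
      ∀ u v → Γ⁺ (mirror 𝒬ᵟ) ⊨ reverseWord u ≈ reverseWord v ⇔ Γ⁺ (mirror 𝒬) ⊨ u ≈ v
    chiral-mirror-dual-⊨ ≡.refl ≡.refl = dual-equality
      {Polytope._^_ P Ψ (opposite zero)} {Polytope._^_ P Ψ zero}
      {Γ⁺ (mirror (chiral (dual P) (dualFlag P Ψ) χᵟ)) ⊨_≈_} {Γ⁺ (mirror (chiral P Ψ χ)) ⊨_≈_}
      (RotationEquality-resp-≃ (dual P)
        {Polytope._^_ (dual P) (dualFlag P Ψ) zero} {dualFlag P (Polytope._^_ P Ψ (opposite zero))}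
        {Γ⁺ (mirror (chiral (dual P) (dualFlag P Ψ) χᵟ)) ⊨_≈_}
        (dualFlag-^-zero Ψ) (Γ⁺-mirror-equality (dual P) (dualFlag P Ψ) χᵟ))
      (Γ⁺-mirror-equality P Ψ χ) (^-sameOrbit (chiral P Ψ χ) Ψ (opposite zero) zero)

module _ {m c ℓ₁ ℓ₂} (𝒫 : ChiralPolytope (suc m) c ℓ₁ ℓ₂) where
  open ChiralPolytope 𝒫

  dual-⊨ : ∀ u v → Γ⁺ (𝒫 ᵟ) ⊨ reverseWord u ≈ reverseWord v ⇔ Γ⁺ 𝒫 ⊨ u ≈ v
  dual-⊨ = chiral-dual-⊨ polytope base isChiral (dual-isChiral polytope isChiral)
    {𝒫} {𝒫 ᵟ} ≡.refl ≡.refl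

  mirror-dual-⊨ : ∀ u v → Γ⁺ (mirror (𝒫 ᵟ)) ⊨ reverseWord u ≈ reverseWord v ⇔ Γ⁺ (mirror 𝒫) ⊨ u ≈ v
  mirror-dual-⊨ = chiral-mirror-dual-⊨ polytope base isChiral (dual-isChiral polytope isChiral)
    {𝒫} {𝒫 ᵟ} ≡.refl ≡.refl

  dual-power : ∀ i q → Γ⁺ 𝒫 ⊨ power q (gen i) ≈ ε → Γ⁺ (𝒫 ᵟ) ⊨ power q (gen (opposite i)) ≈ ε
  dual-power i q e = reverse-power (Γ⁺ (𝒫 ᵟ)) i q (Equivalence.from (dual-⊨ (power q (gen i)) ε) e)

-- Mirror invariance and the count of the mix against the comix.

module _ {m a ℓ} (G : Marked m a ℓ) (p : Fin m → ℕ∞)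
         (powers   : ∀ i q → p i ≡ fin q → G ⊨ power q (gen i) ≈ ε)
         (segments : ∀ {i j} → i Fin.< j → G ⊨ power 2 (segment gen i j) ≈ ε) where

  relators-hold : ∀ {w} → [ p ]⁺ w → G ⊨ w ≈ ε
  relators-hold (powered e)   = powers _ _ e
  relators-hold (squared i<j) = segments i<j

-- `closed` concerns kernels, so it is applied to u v⁻¹ and the result is turned back into a
-- congruence.
mirror-preserves : ∀ {m a b ℓ ℓ′} (K : Marked m a ℓ) (L : Marked m b ℓ′) →
  Mirrored (Kernel (K ⋄ L)) ⊆ Kernel (K ⋄ L) → ∀ {u v} → K ⊨ u ≈ v → L ⊨ u ≈ v →
  K ⊨ mirrorWord u ≈ mirrorWord v × L ⊨ mirrorWord u ≈ mirrorWord v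
mirror-preserves K L closed {u} {v} e e′ = cancel K (proj₁ split) , cancel L (proj₂ split)
  where
  quotient : ∀ {a ℓ} (G : Marked _ a ℓ) → G ⊨ u ≈ v → G ⊨ u ∙ v ⁻¹ ≈ ε
  quotient G = GroupProperties.x≈y⇒x∙y⁻¹≈ε (Marked.group G)

  cancel : ∀ {a ℓ} (G : Marked _ a ℓ) → G ⊨ mirrorWord (u ∙ v ⁻¹) ≈ ε → G ⊨ mirrorWord u ≈ mirrorWord v
  cancel G = GroupProperties.x∙y⁻¹≈ε⇒x≈y (Marked.group G) _ _

  split : K ⊨ mirrorWord (u ∙ v ⁻¹) ≈ ε × L ⊨ mirrorWord (u ∙ v ⁻¹) ≈ ε
  split = Equivalence.to (⋄-⊨ K L (mirrorWord (u ∙ v ⁻¹)) ε)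
    (closed (u ∙ v ⁻¹ , Equivalence.from (⋄-⊨ K L (u ∙ v ⁻¹) ε) (quotient K e , quotient L e′) , refl))

shift-codiagonal : ∀ {k a ℓ} (G : Marked k a ℓ) x y w →
                   G ⊨ w ≈ codiagonal (mapWord inj₁ (x ⁻¹ ∙ y)) → G ⊨ x ∙ w ≈ y
shift-codiagonal G x y w e = G.trans
  (G.∙-congˡ (G.trans e (G.reflexive (≡.cong G.⟦_⟧ (codiagonal-mapWord inj₁ (λ _ → ≡.refl) (x ⁻¹ ∙ y))))))
  (GroupProperties.\\-leftDividesˡ G.group G.⟦ x ⟧ G.⟦ y ⟧)
  where module G = Marked G

module _ {k a₁ a₂ a₃ a₄ ℓ₁ ℓ₂ ℓ₃ ℓ₄} {R S : Presentation (Fin k)}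
         (M : Marked k a₁ ℓ₁) (M̄ : Marked k a₂ ℓ₂) (D : Marked k a₃ ℓ₃) (D̄ : Marked k a₄ ℓ₄)
         (A-R : ∀ {w} → R w → M ⋄ M̄ ⊨ w ≈ ε)
         (B-S : ∀ {w} → S w → D ⋄ D̄ ⊨ w ≈ ε)
         (mirrored : ∀ u v → M ⊨ u ≈ v → D ⊨ u ≈ v → M̄ ⊨ u ≈ v × D̄ ⊨ u ≈ v) where
  private
    module M = Marked M
    module D = Marked D
    module A = Marked (M ⋄ M̄)
    module B = Marked (D ⋄ D̄)

    A⇒M : ∀ u v → M ⋄ M̄ ⊨ u ≈ v → M ⊨ u ≈ v
    A⇒M u v e = proj₁ (Equivalence.to (⋄-⊨ M M̄ u v) e)

    B⇒D : ∀ u v → D ⋄ D̄ ⊨ u ≈ v → D ⊨ u ≈ v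
    B⇒D u v e = proj₁ (Equivalence.to (⋄-⊨ D D̄ u v) e)

    -- This is the inclusion M ∩ D ⊆ A ∩ B.
    strengthen : ∀ u v → M ⊨ u ≈ v → D ⊨ u ≈ v → M ⋄ M̄ ⊨ u ≈ v × D ⋄ D̄ ⊨ u ≈ v
    strengthen u v e e′ =
      Equivalence.from (⋄-⊨ M M̄ u v) (e , proj₁ (mirrored u v e e′)) ,
      Equivalence.from (⋄-⊨ D D̄ u v) (e′ , proj₂ (mirrored u v e e′))

  -- With w as in `comix-sound`, a′w = b holds modulo M and modulo D, hence modulo both mixes.
  comix-separates : ∀ a b a′ b′ →
    Comix R S ⊢ mapWord inj₁ (a ⁻¹ ∙ b) ≈ mapWord inj₁ (a′ ⁻¹ ∙ b′) → M ⊨ a ≈ a′ → D ⊨ b ≈ b′ →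
    M ⋄ M̄ ⊨ a ≈ a′ × D ⋄ D̄ ⊨ b ≈ b′
  comix-separates a b a′ b′ e a≈a′ b≈b′
    with comix-sound A.group B.group A.generator B.generator A-R B-S e
  ... | w , w≈ᴬ , w≈ᴮ =
    GroupProperties.∙-cancelʳ A.group A.⟦ w ⟧ A.⟦ a ⟧ A.⟦ a′ ⟧
      (A.trans {A.⟦ a ∙ w ⟧} {A.⟦ b ⟧} {A.⟦ a′ ∙ w ⟧} aw≈b (A.sym {A.⟦ a′ ∙ w ⟧} {A.⟦ b ⟧} (proj₁ both))) ,
    B.trans {B.⟦ b ⟧} {B.⟦ a′ ∙ w ⟧} {B.⟦ b′ ⟧} (B.sym {B.⟦ a′ ∙ w ⟧} {B.⟦ b ⟧} (proj₂ both)) a′w≈b′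
    where
    aw≈b : M ⋄ M̄ ⊨ a ∙ w ≈ b
    aw≈b = shift-codiagonal (M ⋄ M̄) a b w w≈ᴬ

    a′w≈b′ : D ⋄ D̄ ⊨ a′ ∙ w ≈ b′
    a′w≈b′ = shift-codiagonal (D ⋄ D̄) a′ b′ w w≈ᴮ

    both : M ⋄ M̄ ⊨ a′ ∙ w ≈ b × D ⋄ D̄ ⊨ a′ ∙ w ≈ b
    both = strengthen (a′ ∙ w) b
      (M.trans (M.∙-congʳ (M.sym a≈a′)) (A⇒M (a ∙ w) b aw≈b))
      (D.trans (B⇒D (a′ ∙ w) b′ a′w≈b′) (D.sym b≈b′))

  module _ (δ : Word (Fin k) → Word (Fin k))
           (δ-M : ∀ u v → D ⊨ δ u ≈ δ v ⇔ M ⊨ u ≈ v) (δ-M̄ : ∀ u v → D̄ ⊨ δ u ≈ δ v ⇔ M̄ ⊨ u ≈ v)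
           {g mix comix : ℕ} (∣M∣ : HasCardinality M.group g) (∣A∣ : HasCardinality A.group mix)
           (∣R□S∣ : HasCardinality (R □ S) comix) where
    private
      module ∣M∣ = Inverse ∣M∣
      module ∣A∣ = Inverse ∣A∣
      module ∣R□S∣ = Inverse ∣R□S∣

      -- The value of a⁻¹b in the comix may depend on the words a and b, not only on their classes
      -- modulo A and B, so representatives are fixed once.
      word : Fin mix → Word (Fin k)
      word i = ⋄-word M M̄ (∣A∣.from i)

      word-injective : ∀ i j → M ⋄ M̄ ⊨ word i ≈ word j → i ≡ j
      word-injective i j e = ≡.trans (≡.sym (∣A∣.strictlyInverseˡ i)) (≡.trans
        (∣A∣.to-cong {∣A∣.from i} {∣A∣.from j}
          (A.trans {∣A∣.from i} {A.⟦ word i ⟧} {∣A∣.from j}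
            (A.sym {A.⟦ word i ⟧} {∣A∣.from i} (⋄-word-eval M M̄ (∣A∣.from i)))
            (A.trans {A.⟦ word i ⟧} {A.⟦ word j ⟧} {∣A∣.from j} e (⋄-word-eval M M̄ (∣A∣.from j)))))
        (∣A∣.strictlyInverseˡ j))

      to-injective : ∀ {c ℓ N} {G : Group c ℓ} (∣G∣ : HasCardinality G N) {x y} →
                     Inverse.to ∣G∣ x ≡ Inverse.to ∣G∣ y → Group._≈_ G x y
      to-injective {G = G} ∣G∣ {x} {y} e = Group.trans G (Group.sym G (strictlyInverseʳ x))
        (Group.trans G (from-cong e) (strictlyInverseʳ y))
        where open Inverse ∣G∣

      -- Here a is `word i` and b is `δ (word j)`. The class bD is recorded as the class of `word j`
      -- modulo M, which by `δ-M` carries the same information.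
      pair-code : Fin mix → Fin mix → Fin (comix ℕ.* (g ℕ.* g))
      pair-code i j = combine (∣R□S∣.to (mapWord inj₁ (word i ⁻¹ ∙ δ (word j))))
                              (combine (∣M∣.to M.⟦ word i ⟧) (∣M∣.to M.⟦ word j ⟧))

      pair-code-injective : ∀ i j i′ j′ → pair-code i j ≡ pair-code i′ j′ → i ≡ i′ × j ≡ j′
      pair-code-injective i j i′ j′ e =
        word-injective i i′ (proj₁ separated) ,
        word-injective j j′ (Equivalence.from (⋄-⊨ M M̄ (word j) (word j′))
          ( Equivalence.to (δ-M (word j) (word j′)) (proj₁ δ-separated)
          , Equivalence.to (δ-M̄ (word j) (word j′)) (proj₂ δ-separated)))
        where
        codes = Finₚ.combine-injective _ _ _ _ e
        codes′ = Finₚ.combine-injective (∣M∣.to M.⟦ word i ⟧) _ _ _ (proj₂ codes)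

        separated = comix-separates (word i) (δ (word j)) (word i′) (δ (word j′))
          (to-injective {G = R □ S} ∣R□S∣ (proj₁ codes)) (to-injective {G = M.group} ∣M∣ (proj₁ codes′))
          (Equivalence.from (δ-M (word j) (word j′)) (to-injective {G = M.group} ∣M∣ (proj₂ codes′)))

        δ-separated = Equivalence.to (⋄-⊨ D D̄ (δ (word j)) (δ (word j′))) (proj₂ separated)

      code : Fin (mix ℕ.* mix) → Fin (comix ℕ.* (g ℕ.* g))
      code x = pair-code (proj₁ (remQuot {mix} mix x)) (proj₂ (remQuot {mix} mix x))

      code-injective : ∀ {x y} → code x ≡ code y → x ≡ y
      code-injective {x} {y} e = ≡.trans (≡.sym (Finₚ.combine-remQuot {mix} mix x)) (≡.trans
        (≡.cong₂ combine (proj₁ equal) (proj₂ equal)) (Finₚ.combine-remQuot {mix} mix y))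
        where equal = pair-code-injective _ _ _ _ e

    mix²≤comix*g² : mix ℕ.* mix ℕ.≤ comix ℕ.* (g ℕ.* g)
    mix²≤comix*g² = Finₚ.injective⇒≤ code-injective

-- Clears denominators. The comparison passes to unnormalised rationals, whose numerators and
-- denominators are the given numbers, not reduced ones.
/-*-> : ∀ a b d → (+ a / suc d) * (+ a / suc d) > + b / 1 → b ℕ.* (suc d ℕ.* suc d) ℕ.< a ℕ.* a
/-*-> a b d h with ℚᵘₚ.<-respʳ-≃ square≃ (ℚᵘₚ.<-respˡ-≃ (ℚₚ.toℚᵘ-fromℚᵘ (ℚᵘ.mkℚᵘ (+ b) 0)) (ℚₚ.toℚᵘ-mono-< h))
  where
  square≃ : ℚᵘ._≃_ _ (ℚᵘ.mkℚᵘ (+ a) d ℚᵘ.* ℚᵘ.mkℚᵘ (+ a) d)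
  square≃ = ℚᵘₚ.≃-trans (ℚₚ.toℚᵘ-homo-* (+ a / suc d) (+ a / suc d))
    (ℚᵘₚ.*-cong (ℚₚ.toℚᵘ-fromℚᵘ (ℚᵘ.mkℚᵘ (+ a) d)) (ℚₚ.toℚᵘ-fromℚᵘ (ℚᵘ.mkℚᵘ (+ a) d)))
... | ℚᵘ.*<* lt = ℤₚ.drop‿+<+ (≡.subst₂ ℤ._<_ (≡.sym (ℤₚ.pos-* b _))
        (≡.trans (ℤₚ.*-identityʳ _) (≡.sym (ℤₚ.pos-* a a))) lt)

-- From the type to the relators of the comix, and the conclusion.

order⇒power : ∀ {k a ℓ} (G : Marked k a ℓ) i q → HasOrder (Marked.group G) (Marked.generator G i) (fin q) →
              G ⊨ power q (gen i) ≈ ε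
order⇒power G i q (_ , e , _) = G.trans (G.reflexive (Evaluation.eval-power G.group G.generator q (gen i))) e
  where module G = Marked G

PowersTrivial : ∀ {m c ℓ₁ ℓ₂} → ChiralPolytope (suc m) c ℓ₁ ℓ₂ → (Fin m → ℕ∞) → Set (c ⊔ ℓ₁)
PowersTrivial 𝒬 p = ∀ i q → p i ≡ fin q → Γ⁺ 𝒬 ⊨ power q (gen i) ≈ ε

module _ {m c ℓ₁ ℓ₂} (𝒫 : ChiralPolytope (suc m) c ℓ₁ ℓ₂) (p : Fin m → ℕ∞) where

  hasType⇒powersTrivial : HasType 𝒫 p → PowersTrivial 𝒫 p
  hasType⇒powersTrivial type i q e =
    order⇒power (Γ⁺ 𝒫) i q (≡.subst (HasOrder (Marked.group (Γ⁺ 𝒫)) (σ 𝒫 i)) e (type i))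

  dual-powersTrivial : PowersTrivial 𝒫 p → PowersTrivial (𝒫 ᵟ) (p ∘ opposite)
  dual-powersTrivial powers i q e =
    ≡.subst (λ j → Γ⁺ (𝒫 ᵟ) ⊨ power q (gen j) ≈ ε) (Finₚ.opposite-involutive i)
      (dual-power 𝒫 (opposite i) q (powers (opposite i) q e))

  mix-relators : PowersTrivial 𝒫 p → ∀ {w} → [ p ]⁺ w → Γ⁺ 𝒫 ⋄ Γ⁺ (mirror 𝒫) ⊨ w ≈ ε
  mix-relators powers {w} r = Equivalence.from (⋄-⊨ (Γ⁺ 𝒫) (Γ⁺ (mirror 𝒫)) w ε)
    ( relators-hold (Γ⁺ 𝒫) p powers (σ-segment-squared 𝒫) r
    , relators-hold (Γ⁺ (mirror 𝒫)) p (λ i q e → mirror-power 𝒫 i q (powers i q e))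
        (σ-segment-squared (mirror 𝒫)) r )

corollary5p5 : ∀ {m : ℕ} {c ℓ₁ ℓ₂ : Level} (𝒫 : ChiralPolytope (suc m) c ℓ₁ ℓ₂)
    (p : Fin m → ℕ∞) → HasType 𝒫 p →
    (∣Γ⁺𝒫∣ ∣mix∣ ∣comix∣ : ℕ) .{{_ : NonZero ∣Γ⁺𝒫∣}} →
    HasCardinality (Marked.group (Γ⁺ 𝒫)) ∣Γ⁺𝒫∣ →
    HasCardinality (Marked.group (Γ⁺ 𝒫 ⋄ Γ⁺ (mirror 𝒫))) ∣mix∣ →
    HasCardinality ([ p ]⁺ □ [ p ∘ opposite ]⁺) ∣comix∣ →
    (+ ∣mix∣ / ∣Γ⁺𝒫∣) * (+ ∣mix∣ / ∣Γ⁺𝒫∣) > + ∣comix∣ / 1 →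
    MixIsChiral 𝒫 (𝒫 ᵟ)
corollary5p5 𝒫 p type (suc d) mix comix card card-mix card-comix large (closed , _) =
  ℕₚ.<⇒≱ (/-*-> mix comix d large)
    (mix²≤comix*g² (Γ⁺ 𝒫) (Γ⁺ (mirror 𝒫)) (Γ⁺ (𝒫 ᵟ)) (Γ⁺ (mirror (𝒫 ᵟ)))
      (mix-relators 𝒫 p powers)
      (mix-relators (𝒫 ᵟ) (p ∘ opposite) (dual-powersTrivial 𝒫 p powers))
      -- The inclusion of M ∩ D in M̄ ∩ D̄: if u and v agree modulo M and D, so do their mirrored
      -- words, which means that u and v agree modulo M̄ and D̄.
      (λ u v e e′ → let ē , ē′ = mirror-preserves (Γ⁺ 𝒫) (Γ⁺ (𝒫 ᵟ)) closed {u} {v} e e′ in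
        mirror-⊨ 𝒫 {u} {v} ē , mirror-⊨ (𝒫 ᵟ) {u} {v} ē′)
      reverseWord (dual-⊨ 𝒫) (mirror-dual-⊨ 𝒫) card card-mix card-comix)
  where
  powers = hasType⇒powersTrivial 𝒫 p type
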